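{- Let $m\ge2$ be an integer, let $X$ be a finite set of elements of a metric space with metric $d$, partitioned into $m$ disjoint groups $X_1,\dots,X_m$, let $k_1,\dots,k_m\in\mathbb{Z}^+$ with $|X_i|\ge k_i$ for all $i\in[m]$, $k=\sum_{i=1}^m k_i$, $\varepsilon\in(0,1)$, and $\Delta=d_{max}/d_{min}$. Algorithm SFDM2 (defined in the context), run on $X$ presented as a stream, stores $O\big(\frac{km\log\Delta}{\varepsilon}\big)$ elements, takes $O\big(\frac{k\log\Delta}{\varepsilon}\big)$ time per element for stream processing, and spends $O\big(\frac{k^2m\log\Delta}{\varepsilon}\cdot(m+\log^2 k)\big)$ time for post-processing.
   Context: Each distance computation costs $O(1)$ time. $[m]=\{1,\dots,m\}$. For $S\subseteq X$, $div(S)=\min_{x,y\in S,\,x\ne y}d(x,y)$, and for $x\in X$, $d(x,S)=\min_{y\in S}d(x,y)$; a minimum over the empty set is $+\infty$. Here $d_{min}=\min_{x\neq y\in X}d(x,y)$ and $d_{max}=\max_{x,y\in X}d(x,y)$. Algorithm SFDM2. Stream processing: Let $\mathcal{U}=\{\frac{d_{min}}{(1-\varepsilon)^j}: j\in\mathbb{Z}_{\ge0},\ \frac{d_{min}}{(1-\varepsilon)^j}\in[d_{min},d_{max}]\}$. Initialize $S_\mu=S_{\mu,i}=\emptyset$ for $\mu\in\mathcal{U}$, $i\in[m]$. For each arriving $x\in X$ (one pass) and each $\mu\in\mathcal{U}$: if $|S_\mu|<k$ and $d(x,S_\mu)\ge\mu$, add $x$ to $S_\mu$; and, for the group $i$ with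 $x\in X_i$, if $|S_{\mu,i}|<k$ and $d(x,S_{\mu,i})\ge\mu$, add $x$ to $S_{\mu,i}$. Post-processing: Let $\mathcal{U}'=\{\mu\in\mathcal{U}:|S_\mu|=k\text{ and }|S_{\mu,i}|\ge k_i\ \forall i\in[m]\}$. For each $\mu\in\mathcal{U}'$: (1) Form $S'_\mu$ by picking, for each $i\in[m]$, $\min(k_i,|S_\mu\cap X_i|)$ arbitrary elements of $S_\mu\cap X_i$. (2) Let $S_{all}=S_\mu\cup\bigcup_{i=1}^m S_{\mu,i}$. Start with the collection $\mathcal{C}$ of singleton clusters of $S_{all}$; while there are two different clusters $C_a,C_b\in\mathcal{C}$ with $d(x,y)<\frac{\mu}{m+1}$ for some $x\in C_a,y\in C_b$, replace $C_a,C_b$ by $C_a\cup C_b$. (3) Let $\mathcal{M}_1=(S_{all},\mathcal{I}_1)$ and $\mathcal{M}_2=(S_{all},\mathcal{I}_2)$ be the matroids with $S\in\mathcal{I}_1$ iff $|S\cap X_i|\le k_i$ for all $i\in[m]$, and $S\in\mathcal{I}_2$ iff $|S\cap C|\le1$ for all $C\in\mathcal{C}$. Replace $S'_\mu$ by the output of the Matroid Intersection procedure below on $\mathcal{M}_1,\mathcal{M}_2$ with initial set $S'_\mu$. Return the $S'_\mu$ of maximum diversity among $\mu\in\mathcal{U}'$ with $|S'_\mu|=k$. Matroid Intersection procedure (ground set $V=S_{all}$, initial set $S_0$). Set $S\leftarrow S_0$. For the current $S$ let $V_1=\{x\in V\setminus S:S\cup\{x\}\in\mathcal{I}_1\}$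 and $V_2=\{x\in V\setminus S:S\cup\{x\}\in\mathcal{I}_2\}$ (updated whenever $S$ changes). While $V_1\cap V_2\ne\emptyset$, add to $S$ some $x^*\in\arg\max_{x\in V_1\cap V_2}d(x,S)$. Then build the augmentation graph $G$ of $S$: the digraph on $V\cup\{a,b\}$ ($a,b\notin V$) with edges $(a,x)$ for $x\in V_1$; $(x,b)$ for $x\in V_2$; $(y,x)$ for $x\in V\setminus S$, $y\in S$ with $S\cup\{x\}\notin\mathcal{I}_1$ and $S\cup\{x\}\setminus\{y\}\in\mathcal{I}_1$; and $(x,y)$ for $x\in V\setminus S$, $y\in S$ with $S\cup\{x\}\notin\mathcal{I}_2$ and $S\cup\{x\}\setminus\{y\}\in\mathcal{I}_2$. While $G$ has a directed path from $a$ to $b$, take a shortest such path $P^*$, replace $S$ by the symmetric difference of $S$ and $P^*\setminus\{a,b\}$, and rebuild $G$ for the new $S$. Return $S$. (This last loop is Cunningham's matroid intersection algorithm, and it is understood to be carried out with the known fast implementations of that algorithm due to Chakrabarty et al. (FOCS 2019) and Nguyen (2019).)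
   Formalization: The O-bounds are proved for Δ ≥ Δ₀ for any fixed Δ₀ > 1, with a constant depending on Δ₀ (at Δ = 1 the stated bounds are 0 and fail) and on the constant of the cited matroid intersection implementations, whose O(n r log² r) time is assumed. -}

module Defs where

open import Algebra.Structures using (IsCommutativeRing)
open import Data.Bool.Base using (Bool; true; false; if_then_else_; not; _∧_)
open import Data.Fin.Base using (Fin; zero; suc; toℕ)
import Data.Fin.Properties as Fin
open import Data.Fin.Subset as Subset
  using (Subset; inside; outside; ⁅_⁆; ⋃; ∣_∣; _∩_; _∪_; _─_; _-_)
open import Data.List.Base as List using (List; []; _∷_; length; allFin)
open import Data.List.Membership.Propositional using (_∈_)
open import Data.List.NonEmpty.Base as List⁺ using (List⁺; _∷_; _∷⁺_)
open import Data.List.Relation.Unary.Unique.Propositional using (Unique)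
open import Data.Maybe.Base using (Maybe; just; nothing)
open import Data.Nat.Base as ℕ using (ℕ; zero; suc)
open import Data.Nat.ListAction using (sum)
import Data.Nat.Properties as ℕ
open import Data.Product.Base using (Σ; ∃; ∃-syntax; _×_; _,_; proj₁; proj₂)
open import Data.Unit.Base using (⊤; tt)
open import Data.Vec.Base as Vec using (Vec; []; _∷_)
open import Function.Base using (_∘_)
open import Function.Bundles using (_⇔_)
open import Function.Definitions using (Injective)
open import Relation.Binary.Construct.Closure.ReflexiveTransitive using (Star)
import Relation.Binary.Construct.Add.Supremum.NonStrict as NonStrict
open import Relation.Binary.PropositionalEquality using (_≡_; _≢_)
open import Relation.Binary.Structures using (IsDecTotalOrder)
open import Relation.Nullary using (¬_; does)
open import Relation.Nullary.Construct.Add.Supremum using (_⁺; [_]; ⊤⁺)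

record OrderedField : Set₁ where
  infix  4 _≤_ _<_
  infixl 6 _+_
  infixl 7 _*_
  infix  8 -_
  infixr 9 _^_
  infix  10 _⁻¹
  field
    ℝ                 : Set
    _+_ _*_           : ℝ → ℝ → ℝ
    -_ _⁻¹            : ℝ → ℝ
    0# 1#             : ℝ
    _≤_               : ℝ → ℝ → Set
    isCommutativeRing : IsCommutativeRing _≡_ _+_ _*_ -_ 0# 1#
    0≢1               : 0# ≢ 1#
    *-inverseʳ        : ∀ x → x ≢ 0# → x * x ⁻¹ ≡ 1#
    isDecTotalOrder   : IsDecTotalOrder _≡_ _≤_
    +-monoˡ-≤         : ∀ z {x y} → x ≤ y → x + z ≤ y + z
    *-nonNegative     : ∀ {x y} → 0# ≤ x → 0# ≤ y → 0# ≤ x * y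

  open IsDecTotalOrder isDecTotalOrder public using (_≤?_)

  _<_ : ℝ → ℝ → Set
  x < y = x ≤ y × x ≢ y

  ι : ℕ → ℝ
  ι zero    = 0#
  ι (suc n) = 1# + ι n

  _^_ : ℝ → ℕ → ℝ
  x ^ zero  = 1#
  x ^ suc n = x * x ^ n

-- The real numbers, axiomatised as a complete ordered field (unique up to
-- isomorphism) with its classical decidable order and the base-2 logarithm
-- (determined by its laws on positive numbers).  Classically `archimedean`
-- follows from `lub`; constructively it is separate, as it yields a witness.

record Reals : Set₁ where
  field
    orderedField : OrderedField
  open OrderedField orderedField public
  field
    lub          : (P : ℝ → Set) → ∃ P → (∃[ b ] ∀ x → P x → x ≤ b) →
                   ∃[ s ] (∀ x → P x → x ≤ s) ×
                          (∀ b → (∀ x → P x → x ≤ b) → s ≤ b)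
    archimedean  : ∀ x → ∃[ n ] x ≤ ι n
    log          : ℝ → ℝ
    log-*        : ∀ {x y} → 0# < x → 0# < y → log (x * y) ≡ log x + log y
    log-mono-≤   : ∀ {x y} → 0# < x → x ≤ y → log x ≤ log y
    log-2        : log (1# + 1#) ≡ 1#

record MetricSpace (R : Reals) : Set₁ where
  open Reals R
  field
    Point       : Set
    dist        : Point → Point → ℝ
    nonNegative : ∀ x y → 0# ≤ dist x y
    dist≡0      : ∀ x y → dist x y ≡ 0# ⇔ x ≡ y
    symmetric   : ∀ x y → dist x y ≡ dist y x
    triangle    : ∀ x y z → dist x z ≤ dist x y + dist y z

-- The finite set X is given by an injective enumeration of its points.

record Input (R : Reals) : Set₁ where
  open Reals R
  field
    space           : MetricSpace R
  open MetricSpace space public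
  field
    card            : ℕ
    point           : Fin card → Point
    point-injective : Injective _≡_ _≡_ point
    m               : ℕ
    2≤m             : 2 ℕ.≤ m
    group           : Fin card → Fin m
    quota           : Vec ℕ m
    quota-positive  : ∀ i → 1 ℕ.≤ Vec.lookup quota i
    quota-feasible  : ∀ i → Vec.lookup quota i ℕ.≤
                        length (List.filter (λ x → group x Fin.≟ i) (allFin card))
    ε               : ℝ
    0<ε             : 0# < ε
    ε<1             : ε < 1#

  X : Set
  X = Fin card

  d : X → X → ℝ
  d x y = dist (point x) (point y)

  k : ℕ
  k = Vec.sum quota

  field
    dmin dmax       : ℝ
    dmin-attained   : ∃[ x ] ∃[ y ] x ≢ y × d x y ≡ dmin
    dmin-minimal    : ∀ x y → x ≢ y → dmin ≤ d x y
    dmax-attained   : ∃[ x ] ∃[ y ] d x y ≡ dmax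
    dmax-maximal    : ∀ x y → d x y ≤ dmax

  Δ : ℝ
  Δ = dmax * dmin ⁻¹

-- Computations with unit-cost steps and nondeterministic choices, the latter
-- modelling the choices that the algorithm leaves arbitrary.  Every choice has
-- at least one alternative, so every computation has a terminating run.

data Comp (A : Set) : Set where
  return : A → Comp A
  tick   : Comp A → Comp A
  choose : ∀ n → (Fin (suc n) → Comp A) → Comp A

data _⇓_after_ {A : Set} : Comp A → A → ℕ → Set where
  return : ∀ {a} → return a ⇓ a after 0
  tick   : ∀ {p a t} → p ⇓ a after t → tick p ⇓ a after suc t
  choose : ∀ {n f a t} i → f i ⇓ a after t → choose n f ⇓ a after t

infix 4 _⇓_after_
infixl 1 _>>=_ _>>_

_>>=_ : {A B : Set} → Comp A → (A → Comp B) → Comp B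
return a   >>= g = g a
tick p     >>= g = tick (p >>= g)
choose n f >>= g = choose n (λ i → f i >>= g)

_>>_ : {A B : Set} → Comp A → Comp B → Comp B
p >> q = p >>= λ _ → q

-- One elementary operation: an evaluation of the metric, a comparison, an
-- array access, an arithmetic operation or a list constructor.

op : {A : Set} → A → Comp A
op a = tick (return a)

step : Comp ⊤
step = op tt

steps : ℕ → Comp ⊤
steps zero    = return tt
steps (suc n) = do
  step
  steps n

private
  variable
    A B : Set
    n   : ℕ

-- Vectors are used as random-access arrays, updated in place.

newArray : ∀ n → A → Comp (Vec A n)
newArray n a = do
  steps n
  op (Vec.replicate n a)

read : Vec A n → Fin n → Comp A
read v i = op (Vec.lookup v i)

write : Vec A n → Fin n → A → Comp (Vec A n)
write v i a = op (v Vec.[ i ]≔ a)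

increment : Vec ℕ n → Fin n → Comp (Vec ℕ n)
increment v i = do
  a ← read v i
  write v i (suc a)

listToArray : (xs : List A) → Comp (Vec A (length xs))
listToArray []       = op []
listToArray (x ∷ xs) = do
  v ← listToArray xs
  op (x ∷ v)

size : List A → Comp ℕ
size []       = op 0
size (_ ∷ xs) = do
  s ← size xs
  op (suc s)

append : List A → List A → Comp (List A)
append []       ys = op ys
append (x ∷ xs) ys = do
  zs ← append xs ys
  op (x ∷ zs)

concatenate : List (List A) → Comp (List A)
concatenate []         = op []
concatenate (xs ∷ xss) = do
  ys ← concatenate xss
  append xs ys

forEach : List A → (A → Comp B) → Comp (List B)
forEach []       f = op []
forEach (x ∷ xs) f = do
  y  ← f x
  ys ← forEach xs f
  op (y ∷ ys)

forEachᵛ : Vec A n → (A → Comp B) → Comp (Vec B n)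
forEachᵛ []       f = op []
forEachᵛ (x ∷ xs) f = do
  y  ← f x
  ys ← forEachᵛ xs f
  op (y ∷ ys)

accumulate : (B → A → Comp B) → B → List A → Comp B
accumulate f b []       = op b
accumulate f b (x ∷ xs) = do
  step
  b′ ← f b x
  accumulate f b′ xs

select : (A → Comp Bool) → List A → Comp (List A)
select p []       = op []
select p (x ∷ xs) = do
  b  ← p x
  ys ← select p xs
  op (if b then x ∷ ys else ys)

holdsForAll : (A → Comp Bool) → List A → Comp Bool
holdsForAll p []       = op true
holdsForAll p (x ∷ xs) = do
  b ← p x
  c ← holdsForAll p xs
  op (b ∧ c)

anyOf : List⁺ A → Comp A
anyOf (a ∷ as) = choose (length as) (λ i → op (List.lookup (a ∷ as) i))

arbitraryOrder : List A → Comp (List A)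
arbitraryOrder []       = op []
arbitraryOrder (x ∷ xs) = do
  ys ← arbitraryOrder xs
  choose (length ys) λ i → do
    steps (toℕ i)
    op (List.insertAt ys i x)

-- Partition matroids: at most `capacity b` elements from each block b.

record PartitionMatroid (n : ℕ) : Set where
  field
    blocks   : ℕ
    block    : Vec (Fin blocks) n
    capacity : Vec ℕ blocks

  class : Fin blocks → Subset n
  class b = Vec.map (λ b′ → does (b′ Fin.≟ b)) block

  Independent : Subset n → Set
  Independent S = ∀ b → ∣ S ∩ class b ∣ ℕ.≤ Vec.lookup capacity b

open PartitionMatroid

module Augmentation {n : ℕ} (I₁ I₂ : Subset n → Set) where

  data Node : Set where
    a b    : Node
    vertex : Fin n → Node

  module _ (S : Subset n) where

    data Edge : Node → Node → Set where
      enter : ∀ {x} → x Subset.∉ S → I₁ (S ∪ ⁅ x ⁆) → Edge a (vertex x)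
      leave : ∀ {x} → x Subset.∉ S → I₂ (S ∪ ⁅ x ⁆) → Edge (vertex x) b
      swap₁ : ∀ {x y} → x Subset.∉ S → y Subset.∈ S →
              ¬ I₁ (S ∪ ⁅ x ⁆) → I₁ ((S ∪ ⁅ x ⁆) - y) → Edge (vertex y) (vertex x)
      swap₂ : ∀ {x y} → x Subset.∉ S → y Subset.∈ S →
              ¬ I₂ (S ∪ ⁅ x ⁆) → I₂ ((S ∪ ⁅ x ⁆) - y) → Edge (vertex x) (vertex y)

    -- `PathFrom u xs`: a path from u to b whose vertices after u and before b
    -- are xs.
    data PathFrom (u : Node) : List (Fin n) → Set where
      last : Edge u b → PathFrom u []
      _∷_  : ∀ {x xs} → Edge u (vertex x) → PathFrom (vertex x) xs → PathFrom u (x ∷ xs)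

    AugmentingPath : List (Fin n) → Set
    AugmentingPath = PathFrom a

  Augment : Subset n → Subset n → Set
  Augment S S′ = ∃[ xs ] AugmentingPath S xs
                       × (∀ ys → AugmentingPath S ys → length xs ℕ.≤ length ys)
                       × (let P = ⋃ (List.map ⁅_⁆ xs) in S′ ≡ (S ─ P) ∪ (P ─ S))

  AugmentationLoop : Subset n → Subset n → Set
  AugmentationLoop S S′ = Star Augment S S′ × ¬ ∃ (AugmentingPath S′)

-- An implementation of Cunningham's augmentation loop with the running time
-- O(n r log² r) established by Nguyen and by Chakrabarty et al., for n ground
-- elements and common independent sets of size at most r.  The oracles of
-- partition matroids answer in constant time.  The bound is over all S: an
-- implementation that is fast only for common independent S can be stopped
-- when its time is up, which does not affect `correct`.

record FastCunningham (R : Reals) (c₀ : Reals.ℝ R) : Set where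
  open Reals R
  field
    run     : PartitionMatroid n → PartitionMatroid n → Subset n → Comp (Subset n)
    correct : ∀ (M₁ M₂ : PartitionMatroid n) {S S′ t} →
              Independent M₁ S → Independent M₂ S → run M₁ M₂ S ⇓ S′ after t →
              Augmentation.AugmentationLoop (Independent M₁) (Independent M₂) S S′
    fast    : ∀ (M₁ M₂ : PartitionMatroid n) {S S′ t} → 1 ℕ.≤ n →
              ∀ r → 2 ℕ.≤ r →
              (∀ T → Independent M₁ T → Independent M₂ T → ∣ T ∣ ℕ.≤ r) →
              run M₁ M₂ S ⇓ S′ after t →
              ι t ≤ c₀ * (ι n * ι r * log (ι r) ^ 2)

module SFDM2 (R : Reals) (I : Input R) where
  open Reals R
  open Input I
  open NonStrict _≤_ using (≤⁺-dec)

  -- ⊤⁺ is +∞, the minimum of the empty set.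
  ℝ∞ : Set
  ℝ∞ = ℝ ⁺

  _≤∞?_ : ℝ∞ → ℝ∞ → Bool
  x ≤∞? y = does (≤⁺-dec _≤?_ x y)

  minimum : ℝ∞ → ℝ∞ → Comp ℝ∞
  minimum x y = op (if x ≤∞? y then x else y)

  distance : X → X → Comp ℝ
  distance x y = op (d x y)

  distanceTo : X → List X → Comp ℝ∞
  distanceTo x []      = op ⊤⁺
  distanceTo x (y ∷ S) = do
    δ ← distance x y
    ρ ← distanceTo x S
    minimum [ δ ] ρ

  diversity : List X → Comp ℝ∞
  diversity []      = op ⊤⁺
  diversity (x ∷ S) = do
    δ ← distanceTo x S
    ρ ← diversity S
    minimum δ ρ

  groupOf : X → Comp (Fin m)
  groupOf x = op (group x)

  -- The elements of maximum value, together with that value.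
  maximizers : A × ℝ∞ → List (A × ℝ∞) → Comp (ℝ∞ × List⁺ A)
  maximizers (a , δ) []       = op (δ , (a ∷ []))
  maximizers (a , δ) (c ∷ cs) = do
    (best , as) ← maximizers c cs
    step
    op (if best ≤∞? δ
        then (if δ ≤∞? best then (best , (a ∷⁺ as)) else (δ , (a ∷ [])))
        else (best , as))

  argmax : A × ℝ∞ → List (A × ℝ∞) → Comp A
  argmax c cs = do
    (_ , as) ← maximizers c cs
    anyOf as

  -- Stream processing

  IsGuess : ℝ → Set
  IsGuess μ = (∃[ j ] μ ≡ dmin * ((1# + - ε) ^ j) ⁻¹) × dmin ≤ μ × μ ≤ dmax

  EnumeratesGuesses : List ℝ → Set
  EnumeratesGuesses U = Unique U × (∀ μ → μ ∈ U ⇔ IsGuess μ)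

  -- For a guess μ, `whole` is S_μ and `fair` holds the sets S_{μ,i}.
  record Candidate : Set where
    field
      μ     : ℝ
      whole : List X
      fair  : Vec (List X) m

  State : Set
  State = List Candidate

  initial : List ℝ → State
  initial = List.map λ μ → record { μ = μ ; whole = [] ; fair = Vec.replicate m [] }

  insert : ℝ → X → List X → Comp (List X)
  insert μ x S = do
    s ← size S
    δ ← distanceTo x S
    op (if does (s ℕ.<? k) ∧ ([ μ ] ≤∞? δ) then x ∷ S else S)

  update : X → Candidate → Comp Candidate
  update x record { μ = μ ; whole = S ; fair = F } = do
    S′  ← insert μ x S
    i   ← groupOf x
    Sᵢ  ← read F i
    Sᵢ′ ← insert μ x Sᵢ
    F′  ← write F i Sᵢ′
    op record { μ = μ ; whole = S′ ; fair = F′ }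

  arrive : X → State → Comp State
  arrive x σ = forEach σ (update x)

  consume : List X → State → Comp State
  consume xs σ = accumulate (λ σ′ x → arrive x σ′) σ xs

  stored : State → ℕ
  stored = sum ∘ List.map λ c →
    length (Candidate.whole c) ℕ.+ Vec.sum (Vec.map length (Candidate.fair c))

  -- Post-processing

  eligible : Candidate → Comp Bool
  eligible record { whole = S ; fair = F } = do
    s ← size S
    q ← holdsForAll enough (allFin m)
    op (does (s ℕ.≟ k) ∧ q)
    where
    enough : Fin m → Comp Bool
    enough i = do
      Sᵢ ← read F i
      s  ← size Sᵢ
      q  ← read quota i
      op (does (q ℕ.≤? s))

  -- `pick xs v` goes through xs and keeps an element while its group is below
  -- its quota, where v counts the elements already kept in each group.
  pick : List X → Vec ℕ m → Comp (List X)
  pick []       v = op []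
  pick (x ∷ xs) v = do
    i ← groupOf x
    c ← read v i
    q ← read quota i
    step
    if does (c ℕ.<? q)
      then (do v′ ← increment v i
               S  ← pick xs v′
               op (x ∷ S))
      else pick xs v

  partialSolution : List X → Comp (List X)
  partialSolution S = do
    xs ← arbitraryOrder S
    v  ← newArray m 0
    pick xs v

  member : X → List X → Comp Bool
  member x []       = op false
  member x (y ∷ ys) = do
    b ← member x ys
    op (if does (x Fin.≟ y) then true else b)

  union : List X → List X → Comp (List X)
  union []       ys = op ys
  union (x ∷ xs) ys = do
    zs ← union xs ys
    b  ← member x zs
    op (if b then zs else x ∷ zs)

  unionAll : List (List X) → Comp (List X)
  unionAll []         = op []
  unionAll (xs ∷ xss) = do
    ys ← unionAll xss
    union xs ys

  -- `absorb τ x 𝒞` merges {x} with the clusters of 𝒞 at distance < τ from x and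
  -- also returns the other clusters.  If no two clusters of 𝒞 are at distance
  -- < τ, no further merges become possible, so only distances to x matter.
  absorb : ℝ → X → List (List X) → Comp (List X × List (List X))
  absorb τ x []      = op ((x ∷ []) , [])
  absorb τ x (C ∷ 𝒞) = do
    (D , 𝒟) ← absorb τ x 𝒞
    δ       ← distanceTo x C
    step
    if not ([ τ ] ≤∞? δ)
      then (do E ← append C D
               op (E , 𝒟))
      else op (D , (C ∷ 𝒟))

  cluster : ℝ → List X → Comp (List (List X))
  cluster τ []      = op []
  cluster τ (x ∷ V) = do
    𝒞       ← cluster τ V
    (D , 𝒟) ← absorb τ x 𝒞
    op (D ∷ 𝒟)

  -- Lists the elements of all clusters, each with the index of its cluster.
  label : (𝒞 : List (List X)) → Comp (List (X × Fin (length 𝒞)))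
  label 𝒞 = do
    v   ← listToArray 𝒞
    xss ← forEach (allFin (length 𝒞)) λ j → do
      C ← read v j
      forEach C λ x → op (x , j)
    concatenate xss

  module MatroidIntersection {c₀ : ℝ} (F : FastCunningham R c₀) {n : ℕ}
         (V : Vec X n) (M₁ M₂ : PartitionMatroid n) where

    -- Number of elements of S in each block.
    tally : (M : PartitionMatroid n) → Subset n → Comp (Vec ℕ (blocks M))
    tally M S = do
      v ← newArray (blocks M) 0
      accumulate count v (allFin n)
      where
      count : Vec ℕ (blocks M) → Fin n → Comp (Vec ℕ (blocks M))
      count v x = do
        s ← read S x
        b ← read (block M) x
        if s then increment v b else return v

    -- For x ∉ S with S independent in M and v its tally: is S ∪ {x} independent?
    extends : (M : PartitionMatroid n) → Vec ℕ (blocks M) → Fin n → Comp Bool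
    extends M v x = do
      b ← read (block M) x
      c ← read v b
      q ← read (capacity M) b
      op (does (c ℕ.<? q))

    inV₁∩V₂ : Subset n → Vec ℕ (blocks M₁) → Vec ℕ (blocks M₂) → Fin n → Comp Bool
    inV₁∩V₂ S v₁ v₂ x = do
      s  ← read S x
      e₁ ← extends M₁ v₁ x
      e₂ ← extends M₂ v₂ x
      op (not s ∧ (e₁ ∧ e₂))

    elements : Subset n → Comp (List X)
    elements S = do
      xs ← select (read S) (allFin n)
      forEach xs (read V)

    -- The list contains V₁ ∩ V₂, each element x with the distance d(x,S); it
    -- only shrinks as S grows.  The first argument bounds its length, which
    -- decreases in each iteration, so the second clause is never reached.
    greedy : ℕ → Subset n → Vec ℕ (blocks M₁) → Vec ℕ (blocks M₂) →
             List (Fin n × ℝ∞) → Comp (Subset n)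
    greedy _       S v₁ v₂ []       = op S
    greedy zero    S v₁ v₂ (_ ∷ _)  = op S
    greedy (suc l) S v₁ v₂ (c ∷ cs) = do
      x   ← argmax c cs
      S′  ← write S x inside
      b₁  ← read (block M₁) x
      v₁′ ← increment v₁ b₁
      b₂  ← read (block M₂) x
      v₂′ ← increment v₂ b₂
      ds  ← select (λ (y , _) → inV₁∩V₂ S′ v₁′ v₂′ y) (c ∷ cs)
      p   ← read V x
      ds′ ← forEach ds λ (y , δ) → do
        q ← read V y
        ρ ← distance q p
        δ′ ← minimum [ ρ ] δ
        op (y , δ′)
      greedy l S′ v₁′ v₂′ ds′

    matroidIntersection : Subset n → Comp (Subset n)
    matroidIntersection S₀ = do
      v₁ ← tally M₁ S₀
      v₂ ← tally M₂ S₀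
      xs ← select (inV₁∩V₂ S₀ v₁ v₂) (allFin n)
      T  ← elements S₀
      cs ← forEach xs λ x → do
        p ← read V x
        δ ← distanceTo p T
        op (x , δ)
      l  ← size cs
      S  ← greedy l S₀ v₁ v₂ cs
      FastCunningham.run F M₁ M₂ S

  module _ {c₀ : ℝ} (F : FastCunningham R c₀) where

    augmentedSolution : Candidate → Comp (List X)
    augmentedSolution record { μ = μ ; whole = S ; fair = Sᵢ } = do
      S′  ← partialSolution S
      all ← unionAll (S ∷ Vec.toList Sᵢ)
      τ   ← op (μ * ι (suc m) ⁻¹)
      𝒞   ← cluster τ all
      lab ← label 𝒞
      arr ← listToArray lab
      V   ← forEachᵛ arr (λ (x , _) → op x)
      g   ← forEachᵛ V groupOf
      c   ← forEachᵛ arr (λ (_ , j) → op j)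
      one ← newArray (length 𝒞) 1
      let M₁ = record { blocks = m ; block = g ; capacity = quota }
          M₂ = record { blocks = length 𝒞 ; block = c ; capacity = one }
      S₀  ← forEachᵛ V (λ x → member x S′)
      let open MatroidIntersection F V M₁ M₂
      S″  ← matroidIntersection S₀
      elements S″

    best : List (List X × ℝ∞) → Comp (Maybe (List X))
    best []       = op nothing
    best (c ∷ cs) = do
      S ← argmax c cs
      op (just S)

    postProcess : State → Comp (Maybe (List X))
    postProcess σ = do
      σ′  ← select eligible σ
      Ss  ← forEach σ′ augmentedSolution
      Ss′ ← select (λ S → do s ← size S
                             op (does (s ℕ.≟ k))) Ss
      cs  ← forEach Ss′ λ S → do
        δ ← diversity S
        op (S , δ)
      best cs

{-# OPTIONS --safe #-}

-- A guess dmin / (1 − ε)ʲ is at most dmax, and log (1 / (1 − ε)) ≥ ε, so j is at most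
-- G = log Δ / ε; as Δ ≥ Δ₀ > 1, additive constants are absorbed and there are O(G) guesses.
-- For each guess, S_μ and the m sets S_{μ,i} have at most k elements, so that S_all has at most
-- u = 2km elements, and every step of the post-processing other than Cunningham's loop takes
-- time O(u²); in particular the greedy phase has at most u rounds of time O(u).  A set that is
-- independent in the first matroid has at most k elements, whence the loop takes time
-- O(u k log² k).

module Submission where

open import Defs
open import Algebra.Bundles using (CommutativeRing)
import Algebra.Properties.Ring
import Algebra.Solver.Ring.NaturalCoefficients.Default
open import Data.Bool.Base using (Bool; T; true; false; if_then_else_; not; _∧_)
open import Data.Fin.Base using (Fin; zero; suc; fromℕ<)
import Data.Fin.Properties as Fin
open import Data.Fin.Subset using (Subset; inside; outside; _∩_; ∣_∣)
open import Data.List.Base as List using (List; []; _∷_; _++_; allFin; length; lookup; map; tabulate)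
open import Data.List.Membership.Propositional.Properties using (∈-lookup)
open import Data.List.NonEmpty.Base using (List⁺; _∷_)
open import Data.List.Properties using (length-insertAt; length-tabulate; map-tabulate)
open import Data.List.Relation.Binary.Permutation.Propositional using (_↭_)
open import Data.List.Relation.Binary.Pointwise using (Pointwise; []; _∷_; Pointwise-length)
open import Data.List.Relation.Unary.All as All using (All; []; _∷_)
open import Data.List.Relation.Unary.AllPairs using (_∷_)
open import Data.List.Relation.Unary.Unique.Propositional using (Unique)
open import Data.Nat.Base as ℕ using (ℕ; zero; suc)
open import Data.Nat.ListAction using (sum)
import Data.Nat.Properties as ℕ
open import Data.Nat.Tactic.RingSolver using (solve-∀)
open import Data.Product.Base using (Σ; _×_; _,_; proj₁; proj₂; ∃-syntax)
open import Data.Sum.Base using (inj₁; inj₂)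
open import Data.Unit.Base using (⊤; tt)
open import Data.Vec.Base as Vec using (Vec; []; _∷_)
import Data.Vec.Properties as Vec
open import Function.Base using (_∘_)
open import Function.Bundles using (Equivalence)
open import Level using (0ℓ)
open import Relation.Binary.Bundles using (Poset)
open import Relation.Binary.PropositionalEquality
  using (_≡_; _≢_; refl; sym; trans; cong; cong₂; subst; subst₂)
import Relation.Binary.Reasoning.PartialOrder
open import Relation.Binary.Structures using (IsDecTotalOrder)
open import Relation.Nullary using (¬_; contradiction; does; yes; no)
import Relation.Nullary.Construct.Add.Supremum as Supremum

-- Step counts are natural numbers, while the claimed bounds are real. Counting therefore stays in
-- ℕ, with costs as multiples of a unit: first `u`, later w = u² + ρ, where ρ is the real bound on
-- Cunningham's loop rounded up. One guess then costs a numeral times w, and the post-processing of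
-- g guesses at most 175 (g + 1) w. The bound on the loop is available only for a nonempty ground
-- set and r ≥ 2. The former is drawn from the eligibility test, |S_μ| = k, and carried through the
-- formation of S_all; the latter follows from m ≥ 2 and the positivity of the quotas. The logarithm
-- is given only by its functional equation, its monotonicity and log 2 = 1, so that log (1 / (1 -
-- ε)) ≥ ε has to come from Bernoulli's inequality instead of a derivative. The constant is fixed
-- before the input and depends only on Δ₀ and c₀. Some Δ₀ > 1 is essential: for Δ = 1 the claimed
-- bounds are 0, although elements are stored.

-- Step counting with postconditions

module Computations where
  open import Data.Nat.Base
  open import Data.Nat.Properties

  private
    variable
      A B : Set
      a b c n u u′ : ℕ
      xs ys : List A

  -- Every run of p takes at most a * u steps and ends in Q.  The unit u absorbs the sizes of the
  -- data, so that the coefficients a of straight-line code are numerals, added up by evaluation.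
  record Takes {A : Set} (p : Comp A) (a u : ℕ) (Q : A → Set) : Set where
    constructor takes
    field
      bound : ∀ {r t} → p ⇓ r after t → t ≤ a * u × Q r

  open Takes public

  Always : A → Set
  Always _ = ⊤

  >>=-inverse : (p : Comp A) {g : A → Comp B} {r : B} {t : ℕ} → (p >>= g) ⇓ r after t →
                ∃[ q ] ∃[ t₁ ] ∃[ t₂ ] p ⇓ q after t₁ × g q ⇓ r after t₂ × t ≡ t₁ + t₂
  >>=-inverse (return q)   e            = q , _ , _ , return , e , refl
  >>=-inverse (tick p)     (tick e)     =
    let q , t₁ , t₂ , e₁ , e₂ , t≡ = >>=-inverse p e in q , _ , t₂ , tick e₁ , e₂ , cong suc t≡
  >>=-inverse (choose n f) (choose i e) =
    let q , t₁ , t₂ , e₁ , e₂ , t≡ = >>=-inverse (f i) e in q , t₁ , t₂ , choose i e₁ , e₂ , t≡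

  infixr 1 _⨾_

  -- Sequencing as in Hoare logic: the postcondition of the first part is the hypothesis of the
  -- second. Since both share the unit `u`, their coefficients simply add.
  _⨾_ : {p : Comp A} {g : A → Comp B} {P : A → Set} {Q : B → Set} →
        Takes p a u P → (∀ x → P x → Takes (g x) b u Q) → Takes (p >>= g) (a + b) u Q
  _⨾_ {a = a} {u = u} {b = b} {p = p} T T′ .bound e
    with q , t₁ , t₂ , e₁ , e₂ , refl ← >>=-inverse p e
    with t₁≤ , Pq ← bound T e₁
    with t₂≤ , Qr ← bound (T′ q Pq) e₂
    = subst (t₁ + t₂ ≤_) (sym (*-distribʳ-+ u a b)) (+-mono-≤ t₁≤ t₂≤) , Qr

  tick-takes : {{NonZero u}} → {p : Comp A} {Q : A → Set} → Takes p a u Q → Takes (tick p) (suc a) u Q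
  tick-takes {u = u} T .bound (tick e) with t≤ , Qr ← bound T e = +-mono-≤ (>-nonZero⁻¹ u) t≤ , Qr

  return-takes : {x : A} {Q : A → Set} → Q x → Takes (return x) 0 u Q
  return-takes Qx .bound return = z≤n , Qx

  op-takes : {{NonZero u}} → {x : A} {Q : A → Set} → Q x → Takes (op x) 1 u Q
  op-takes Qx = tick-takes (return-takes Qx)

  choose-takes : {f : Fin (suc n) → Comp A} {Q : A → Set} →
                 (∀ i → Takes (f i) a u Q) → Takes (choose n f) a u Q
  choose-takes T .bound (choose i e) = bound (T i) e

  weaken : {p : Comp A} {Q : A → Set} → a * u ≤ b * u′ → Takes p a u Q → Takes p b u′ Q
  weaken au≤bu′ T .bound e with t≤ , Qr ← bound T e = ≤-trans t≤ au≤bu′ , Qr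

  atMost : {p : Comp A} {Q : A → Set} → a ≤ b → Takes p a u Q → Takes p b u Q
  atMost {u = u} a≤b = weaken (*-monoˡ-≤ u a≤b)

  exactly : {p : Comp A} {Q : A → Set} → a ≡ b → Takes p a u Q → Takes p b u Q
  exactly a≡b = atMost (≤-reflexive a≡b)

  raise : {p : Comp A} {Q : A → Set} → u ≤ u′ → Takes p a u Q → Takes p a u′ Q
  raise {a = a} u≤u′ = weaken (*-monoʳ-≤ a u≤u′)

  entails : {p : Comp A} {P Q : A → Set} → (∀ x → P x → Q x) → Takes p a u P → Takes p a u Q
  entails P⇒Q T .bound e with t≤ , Pr ← bound T e = t≤ , P⇒Q _ Pr

  -- 1 + n * c is the cost of n rounds of cost c and of the final operation on the empty list.
  loop : ∀ n {p : Comp A} {Q : A → Set} → n * u ≤ u′ → u ≤ u′ →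
         Takes p (1 + n * c) u Q → Takes p (1 + c) u′ Q
  loop {u = u} {u′ = u′} {c = c} n nu≤u′ u≤u′ = weaken (begin
    (1 + n * c) * u ≡⟨ eq n c u ⟩
    u + c * (n * u) ≤⟨ +-mono-≤ u≤u′ (*-monoʳ-≤ c nu≤u′) ⟩
    (1 + c) * u′    ∎)
    where
    open ≤-Reasoning
    eq : ∀ n c u → (1 + n * c) * u ≡ u + c * (n * u)
    eq = solve-∀

  *1-≤ : n ≤ u → n * 1 ≤ u
  *1-≤ n≤u = ≤-trans (≤-reflexive (*-identityʳ _)) n≤u

  loop₁ : {{NonZero u}} → {p : Comp A} {Q : A → Set} → n ≤ u →
          Takes p (1 + n * c) 1 Q → Takes p (1 + c) u Q
  loop₁ {u = u} {n = n} n≤u = loop n (*1-≤ n≤u) (>-nonZero⁻¹ u)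

  -- For recursions over a list of lists, whose rounds are counted by the lists together with their
  -- elements. Each of the two counts is bounded on its own, which doubles `c` but leaves the unit
  -- alone.
  loop₂ : ∀ l n {p : Comp A} {Q : A → Set} → l * u ≤ u′ → n * u ≤ u′ → u ≤ u′ →
          Takes p (1 + (l + n) * c) u Q → Takes p (1 + (c + c)) u′ Q
  loop₂ {u = u} {u′ = u′} {c = c} l n lu≤u′ nu≤u′ u≤u′ = weaken (begin
    (1 + (l + n) * c) * u           ≡⟨ eq l n c u ⟩
    u + (c * (l * u) + c * (n * u)) ≤⟨ +-mono-≤ u≤u′
                                         (+-mono-≤ (*-monoʳ-≤ c lu≤u′) (*-monoʳ-≤ c nu≤u′)) ⟩
    u′ + (c * u′ + c * u′)          ≡⟨ eq′ c u′ ⟩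
    (1 + (c + c)) * u′              ∎)
    where
    open ≤-Reasoning
    eq : ∀ l n c u → (1 + (l + n) * c) * u ≡ u + (c * (l * u) + c * (n * u))
    eq = solve-∀
    eq′ : ∀ c u → u + (c * u + c * u) ≡ (1 + (c + c)) * u
    eq′ = solve-∀

  -- The cons case of a recursion on lists: `a` is spent before the recursive call and `b` after it.
  round : ∀ a b n {p : Comp A} {Q : A → Set} →
          Takes p (a + ((1 + n * (a + b)) + b)) u Q → Takes p (1 + suc n * (a + b)) u Q
  round a b n = exactly (eq a b n)
    where
    eq : ∀ a b n → a + ((1 + n * (a + b)) + b) ≡ 1 + suc n * (a + b)
    eq = solve-∀

  if-takes : ∀ b {p q : Comp A} {Q : A → Set} →
             Takes p a u Q → Takes q a u Q → Takes (if b then p else q) a u Q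
  if-takes true  T T′ = T
  if-takes false T T′ = T′

  steps-takes : {{NonZero u}} → ∀ n → Takes (steps n) n u Always
  steps-takes zero    = return-takes tt
  steps-takes (suc n) = tick-takes (steps-takes n)

  -- The redundant factor 1 gives the bound the shape `1 + n * c` that `loop₁` consumes.
  newArray-takes : ∀ n {x : A} → Takes (newArray n x) (1 + n * 1) 1 Always
  newArray-takes n = exactly (eq n) (steps-takes n ⨾ λ _ _ → op-takes tt)
    where
    eq : ∀ n → n + 1 ≡ 1 + n * 1
    eq = solve-∀

  listToArray-takes : (xs : List A) →
                      Takes (listToArray xs) (1 + length xs * 1) 1 (_≡ Vec.fromList xs)
  listToArray-takes []       = op-takes refl
  listToArray-takes (x ∷ xs) = round 0 1 (length xs)
    (listToArray-takes xs ⨾ λ { v refl → op-takes refl })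

  size-takes : (xs : List A) → Takes (size xs) (1 + length xs * 1) 1 (_≡ length xs)
  size-takes []       = op-takes refl
  size-takes (x ∷ xs) = round 0 1 (length xs)
    (size-takes xs ⨾ λ { s refl → op-takes refl })

  append-takes : (xs ys : List A) →
                 Takes (append xs ys) (1 + length xs * 1) 1 (λ zs → length zs ≡ length xs + length ys)
  append-takes []       ys = op-takes refl
  append-takes (x ∷ xs) ys = round 0 1 (length xs)
    (append-takes xs ys ⨾ λ zs eq → op-takes (cong suc eq))

  totalLength : List (List A) → ℕ
  totalLength xss = sum (map length xss)

  concatenate-takes : (xss : List (List A)) →
                      Takes (concatenate xss) (1 + (length xss + totalLength xss) * 1) 1
                            (λ ys → length ys ≡ totalLength xss)
  concatenate-takes []         = op-takes refl
  concatenate-takes (xs ∷ xss) = exactly (eq (length xss) (totalLength xss) (length xs))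
    (concatenate-takes xss ⨾ λ ys ys≡ →
     entails (λ zs zs≡ → trans zs≡ (cong (length xs +_) ys≡)) (append-takes xs ys))
    where
    eq : ∀ l t s → (1 + (l + t) * 1) + (1 + s * 1) ≡ 1 + (suc l + (s + t)) * 1
    eq = solve-∀

  forEach-takes : {{NonZero u}} → {f : A → Comp B} {P : A → Set} {Q : A → B → Set} →
                  (∀ x → P x → Takes (f x) a u (Q x)) → All P xs →
                  Takes (forEach xs f) (1 + length xs * (a + 1)) u (Pointwise Q xs)
  forEach-takes T [] = op-takes []
  forEach-takes {a = a} {xs = x ∷ xs} T (px ∷ pxs) = round a 1 (length xs)
    (T x px ⨾ λ y qy → forEach-takes T pxs ⨾ λ ys qys → op-takes (qy ∷ qys))

  forEach-takes′ : {{NonZero u}} → {f : A → Comp B} {Q : A → B → Set} →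
                   (∀ x → Takes (f x) a u (Q x)) → (xs : List A) →
                   Takes (forEach xs f) (1 + length xs * (a + 1)) u (Pointwise Q xs)
  forEach-takes′ T xs = forEach-takes (λ x _ → T x) (All.universal (λ _ → tt) xs)

  forEachᵛ-takes : {{NonZero u}} → {f : A → Comp B} → (∀ x → Takes (f x) a u Always) → (v : Vec A n) →
                   Takes (forEachᵛ v f) (1 + n * (a + 1)) u Always
  forEachᵛ-takes T [] = op-takes tt
  forEachᵛ-takes {a = a} {n = suc n} T (x ∷ v) = round a 1 n
    (T x ⨾ λ _ _ → forEachᵛ-takes T v ⨾ λ _ _ → op-takes tt)

  accumulate-takes : {{NonZero u}} → {f : B → A → Comp B} {Inv : B → Set} →
                     (∀ y x → Inv y → Takes (f y x) a u Inv) → ∀ {y} → Inv y → (xs : List A) →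
                     Takes (accumulate f y xs) (1 + length xs * (1 + a)) u Inv
  accumulate-takes T inv []       = op-takes inv
  accumulate-takes {a = a} T inv (x ∷ xs) = exactly (eq a (length xs))
    (tick-takes (T _ x inv ⨾ λ y′ inv′ → accumulate-takes T inv′ xs))
    where
    eq : ∀ a n → suc (a + (1 + n * (1 + a))) ≡ 1 + suc n * (1 + a)
    eq = solve-∀

  -- The postcondition of the test speaks only of the answer `true`, so whatever passing the test
  -- guarantees becomes known of every selected element.
  select-takes : {{NonZero u}} → {p : A → Comp Bool} {P Q : A → Set} →
                 (∀ x → P x → Takes (p x) a u (λ b → b ≡ true → Q x)) → All P xs →
                 Takes (select p xs) (1 + length xs * (a + 1)) u
                       (λ ys → length ys ≤ length xs × All Q ys)
  select-takes T [] = op-takes (z≤n , [])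
  select-takes {a = a} {xs = x ∷ xs} {Q = Q} T (px ∷ pxs) = round a 1 (length xs)
    (T x px ⨾ λ b qx → select-takes T pxs ⨾ λ ys (ys≤ , qys) → op-takes (keep b qx ys≤ qys))
    where
    keep : ∀ b {ys} → (b ≡ true → Q x) → length ys ≤ length xs → All Q ys →
           let zs = if b then x ∷ ys else ys in length zs ≤ suc (length xs) × All Q zs
    keep true  qx ys≤ qys = s≤s ys≤ , qx refl ∷ qys
    keep false qx ys≤ qys = m≤n⇒m≤1+n ys≤ , qys

  select-takes′ : {{NonZero u}} → {p : A → Comp Bool} → (∀ x → Takes (p x) a u Always) → (xs : List A) →
                  Takes (select p xs) (1 + length xs * (a + 1)) u (λ ys → length ys ≤ length xs)
  select-takes′ T xs = entails (λ _ → proj₁)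
    (select-takes {P = Always} {Q = Always} (λ x _ → entails (λ _ _ _ → tt) (T x))
      (All.universal (λ _ → tt) xs))

  holdsForAll-takes : {{NonZero u}} → {p : A → Comp Bool} → (∀ x → Takes (p x) a u Always) →
                      (xs : List A) → Takes (holdsForAll p xs) (1 + length xs * (a + 1)) u Always
  holdsForAll-takes T [] = op-takes tt
  holdsForAll-takes {a = a} T (x ∷ xs) = round a 1 (length xs)
    (T x ⨾ λ _ _ → holdsForAll-takes T xs ⨾ λ _ _ → op-takes tt)

  anyOf-takes : {{NonZero u}} → (xs : List⁺ A) → Takes (anyOf xs) 1 u Always
  anyOf-takes (x ∷ xs) = choose-takes (λ i → op-takes tt)

  arbitraryOrder-takes : {{NonZero u}} → (xs : List A) → length xs ≤ u →
                         Takes (arbitraryOrder xs) (1 + length xs * 2) u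
                               (λ ys → length ys ≡ length xs)
  arbitraryOrder-takes []       _   = op-takes refl
  arbitraryOrder-takes {u = u} (x ∷ xs) xs≤u = round 0 2 (length xs)
    (arbitraryOrder-takes xs (≤-trans (n≤1+n _) xs≤u) ⨾ λ ys eq → choose-takes λ i →
     steps≤u (≤-trans (Fin.toℕ≤pred[n] i) (≤-trans (≤-reflexive eq) (≤-trans (n≤1+n _) xs≤u)))
     ⨾ λ _ _ → op-takes (inserted ys i eq))
    where
    steps≤u : n ≤ u → Takes (steps n) 1 u Always
    steps≤u {n} n≤u = weaken (≤-trans (≤-reflexive (*-identityʳ n)) (≤-trans n≤u (m≤m+n u _)))
                             (steps-takes n)
    inserted : ∀ ys (i : Fin (suc (length ys))) → length ys ≡ length xs →
               length (List.insertAt ys i x) ≡ suc (length xs)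
    inserted ys i eq = trans (length-insertAt ys i x) (cong suc eq)

  open PartitionMatroid

  -- Induction on the ground set: an element of S uses up one unit of the capacity of its block, and
  -- the remaining elements are independent for the capacities so lowered. That capacity is positive
  -- because the element itself is counted in its block.
  ∣independent∣≤ : (M : PartitionMatroid n) (S : Subset n) → Independent M S →
                  ∣ S ∣ ≤ Vec.sum (capacity M)
  ∣independent∣≤ M S = go (block M) S (capacity M)
    where
    go : ∀ {n l} (bs : Vec (Fin l) n) (S : Subset n) (q : Vec ℕ l) →
         (∀ b → ∣ S ∩ Vec.map (λ b′ → does (b′ Fin.≟ b)) bs ∣ ≤ Vec.lookup q b) →
         ∣ S ∣ ≤ Vec.sum q
    sum-decrement : ∀ {l} (q : Vec ℕ l) b → 1 ≤ Vec.lookup q b →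
                    suc (Vec.sum (Vec.updateAt q b pred)) ≡ Vec.sum q
    sum-decrement (suc _ ∷ q) zero    _   = refl
    sum-decrement (x ∷ q)     (suc b) 1≤q = trans (sym (+-suc x _)) (cong (x +_) (sum-decrement q b 1≤q))
    go []       []            q ind = z≤n
    go (c ∷ bs) (outside ∷ S) q ind = go bs S q ind
    go (c ∷ bs) (inside ∷ S)  q ind = begin
      suc ∣ S ∣                              ≤⟨ s≤s (go bs S (Vec.updateAt q c pred) ind′) ⟩
      suc (Vec.sum (Vec.updateAt q c pred))  ≡⟨ sum-decrement q c 1≤qc ⟩
      Vec.sum q                              ∎
      where
      open ≤-Reasoning
      1≤qc : 1 ≤ Vec.lookup q c
      1≤qc with c Fin.≟ c | ind c
      ... | yes _  | i = ≤-trans (s≤s z≤n) i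
      ... | no c≢c | _ with () ← c≢c refl
      ind′ : ∀ b → ∣ S ∩ Vec.map (λ b′ → does (b′ Fin.≟ b)) bs ∣ ≤ Vec.lookup (Vec.updateAt q c pred) b
      ind′ b with c Fin.≟ b | ind b
      ... | yes refl | i = subst (_ ≤_) (sym (Vec.lookup∘updateAt c q)) (pred-mono-≤ i)
      ... | no c≢b   | i = subst (_ ≤_) (sym (Vec.lookup∘updateAt′ b c (λ b≡c → c≢b (sym b≡c)) q)) i

-- Running times of the procedures of SFDM2: distances and stream processing

module RunningTimes (R : Reals) (I : Input R) where
  open import Data.Nat.Base
  open import Data.Nat.Properties
  open Computations
  open PartitionMatroid
  open Reals R using (ℝ)
  open Input I using (X; m; k; quota; group)
  open SFDM2 R I

  private
    variable
      A B : Set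
      u : ℕ

  distanceTo-takes : ∀ x S → Takes (distanceTo x S) (1 + length S * 2) 1 Always
  distanceTo-takes x []      = op-takes tt
  distanceTo-takes x (y ∷ S) = round 1 1 (length S)
    (tick-takes (distanceTo-takes x S ⨾ λ _ _ → op-takes tt))

  diversity-takes : ∀ {{_ : NonZero u}} S → length S ≤ u → Takes (diversity S) (1 + length S * 4) u Always
  diversity-takes []      _   = op-takes tt
  diversity-takes (x ∷ S) S≤u = round 3 1 (length S)
    (loop₁ S≤u′ (distanceTo-takes x S) ⨾ λ _ _ → diversity-takes S S≤u′ ⨾ λ _ _ → op-takes tt)
    where S≤u′ = ≤-trans (n≤1+n _) S≤u

  maximizers-takes : (c : A × ℝ∞) (cs : List (A × ℝ∞)) →
                     Takes (maximizers c cs) (1 + length cs * 2) 1 Always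
  maximizers-takes (a , δ) []       = op-takes tt
  maximizers-takes (a , δ) (c ∷ cs) = round 0 2 (length cs)
    (maximizers-takes c cs ⨾ λ _ _ → tick-takes (op-takes tt))

  argmax-takes : (c : A × ℝ∞) (cs : List (A × ℝ∞)) →
                 Takes (argmax c cs) (2 + length cs * 2) 1 Always
  argmax-takes c cs = exactly (+-comm _ 1) (maximizers-takes c cs ⨾ λ (_ , as) _ → anyOf-takes as)

  insert-takes : ∀ {{_ : NonZero k}} μ x S → length S ≤ k →
                 Takes (insert μ x S) 6 k (λ S′ → length S′ ≤ k)
  insert-takes μ x S S≤k =
    loop₁ S≤k (size-takes S) ⨾ λ { s refl →
    loop₁ S≤k (distanceTo-takes x S) ⨾ λ δ _ →
    op-takes (inserted ([ μ ] ≤∞? δ)) }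
    where
    open import Relation.Nullary.Construct.Add.Supremum using ([_])
    inserted : ∀ b → length (if does (length S <? k) ∧ b then x ∷ S else S) ≤ k
    inserted b with length S <ᵇ k in eq
    inserted true  | true  = <ᵇ⇒< _ _ (subst T (sym eq) tt)
    inserted false | true  = S≤k
    inserted _     | false = S≤k

  record Bounded (c : Candidate) : Set where
    constructor bounded
    open Candidate c
    field
      whole≤k : length whole ≤ k
      fair≤k  : ∀ i → length (Vec.lookup fair i) ≤ k

  update-takes : ∀ {{_ : NonZero k}} x c → Bounded c → Takes (update x c) 16 k Bounded
  update-takes x record { μ = μ ; whole = S ; fair = F } (bounded S≤k F≤k) =
    insert-takes μ x S S≤k ⨾ λ S′ S′≤k → tick-takes (tick-takes (
    insert-takes μ x (Vec.lookup F (group x)) (F≤k (group x)) ⨾ λ Sᵢ Sᵢ≤k → tick-takes (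
    op-takes (bounded S′≤k (updated Sᵢ Sᵢ≤k)))))
    where
    updated : ∀ Sᵢ → length Sᵢ ≤ k → ∀ i → length (Vec.lookup (F Vec.[ group x ]≔ Sᵢ) i) ≤ k
    updated Sᵢ Sᵢ≤k i with i Fin.≟ group x
    ... | yes refl = subst (λ S → length S ≤ k) (sym (Vec.lookup∘update i F Sᵢ)) Sᵢ≤k
    ... | no i≢g   = subst (λ S → length S ≤ k) (sym (Vec.lookup∘update′ i≢g F Sᵢ)) (F≤k i)

  -- Arrivals neither add nor drop candidates. Fixing their number `g` in the invariant makes the
  -- cost of every arrival the same expression in `g`.
  Invariant : ℕ → State → Set
  Invariant g σ = length σ ≡ g × All Bounded σ

  initial-invariant : ∀ U → Invariant (length U) (initial U)
  initial-invariant []      = refl , []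
  initial-invariant (μ ∷ U) with len , σ-bounded ← initial-invariant U =
    cong suc len ,
    bounded z≤n (λ i → subst (λ S → length S ≤ k) (sym (Vec.lookup-replicate i [])) z≤n) ∷ σ-bounded

  arrive-takes : ∀ {{_ : NonZero k}} {g} x σ → Invariant g σ →
                 Takes (arrive x σ) (1 + g * 17) k (Invariant g)
  arrive-takes x σ (refl , σ-bounded) =
    entails preserved (forEach-takes {Q = λ _ → Bounded} (update-takes x) σ-bounded)
    where
    preserved : ∀ {σ} σ′ → Pointwise (λ _ → Bounded) σ σ′ → Invariant (length σ) σ′
    preserved []       []       = refl , []
    preserved (c′ ∷ σ′) (b ∷ bs) with len , σ′-bounded ← preserved σ′ bs = cong suc len , b ∷ σ′-bounded

  consume-takes : ∀ {{_ : NonZero k}} {g} xs σ → Invariant g σ →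
                  Takes (consume xs σ) (1 + length xs * (2 + g * 17)) k (Invariant g)
  consume-takes xs σ inv = accumulate-takes (λ σ x → arrive-takes x σ) inv xs

  stored≤ : ∀ {g} σ → Invariant g σ → stored σ ≤ g * (k + m * k)
  stored≤ []      (refl , [])               = z≤n
  stored≤ (c ∷ σ) (refl , bounded S≤k F≤k ∷ bs) =
    +-mono-≤ (+-mono-≤ S≤k (lengths≤ (Candidate.fair c) F≤k)) (stored≤ σ (refl , bs))
    where
    lengths≤ : ∀ {n} (F : Vec (List X) n) → (∀ i → length (Vec.lookup F i) ≤ k) →
               Vec.sum (Vec.map length F) ≤ n * k
    lengths≤ []      F≤k = z≤n
    lengths≤ (S ∷ F) F≤k = +-mono-≤ (F≤k zero) (lengths≤ F (λ i → F≤k (suc i)))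

  -- Post-processing of one guess: eligibility, partial solution, S_all and its clusters

  -- Of the test, the part |S_μ| = k is remembered: as k is positive, it makes S_all nonempty, as
  -- the time bound for Cunningham's loop presupposes. The unit m k pays for measuring m lists of at
  -- most k elements.
  eligible-takes : ∀ {{_ : NonZero k}} {{_ : NonZero m}} c → Bounded c →
                   Takes (eligible c) 10 (m * k) (λ b → b ≡ true → length (Candidate.whole c) ≡ k)
  eligible-takes record { whole = S ; fair = F } (bounded S≤k F≤k) =
    raise (m≤n*m k m) (loop₁ S≤k (size-takes S)) ⨾ λ { s refl →
    loop (length (allFin m)) (*-monoˡ-≤ k (≤-reflexive (length-tabulate {n = m} (λ i → i)))) (m≤n*m k m)
      (holdsForAll-takes (λ i → tick-takes (
        loop₁ (F≤k i) (size-takes (Vec.lookup F i)) ⨾ λ _ _ →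
        tick-takes (op-takes tt))) (allFin m)) ⨾ λ q _ →
    op-takes (full q) }
    where
    instance _ = m*n≢0 m k
    full : ∀ q → does (length S ≟ k) ∧ q ≡ true → length S ≡ k
    full q eq with length S ≡ᵇ k in eq′
    ... | true = ≡ᵇ⇒≡ _ _ (subst T (sym eq′) tt)

  pick-takes : ∀ xs v → Takes (pick xs v) (1 + length xs * 7) 1 (λ S → length S ≤ length xs)
  pick-takes []       v = op-takes z≤n
  pick-takes (x ∷ xs) v = round 4 3 (length xs)
    (tick-takes (tick-takes (tick-takes (tick-takes
      (if-takes (does (Vec.lookup v (group x) <? Vec.lookup quota (group x)))
        (exactly (eq (length xs)) (tick-takes (tick-takes
          (pick-takes xs _ ⨾ λ S S≤ → op-takes (s≤s S≤)))))
        (atMost (m≤m+n _ 3) (entails (λ _ → m≤n⇒m≤1+n) (pick-takes xs v))))))))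
    where
    eq : ∀ n → 2 + ((1 + n * 7) + 1) ≡ (1 + n * 7) + 3
    eq = solve-∀

  partialSolution-takes : ∀ {{_ : NonZero u}} S → length S ≤ u → m ≤ u →
                          Takes (partialSolution S) 13 (u * u) (λ S′ → length S′ ≤ length S)
  partialSolution-takes {u} S S≤u m≤u =
    loop (length S) (*-monoˡ-≤ u S≤u) u≤u² (arbitraryOrder-takes S S≤u) ⨾ λ xs xs≡ →
    raise u≤u² (loop₁ m≤u (newArray-takes m)) ⨾ λ v _ →
    entails (λ _ S′≤ → ≤-trans S′≤ (≤-reflexive xs≡))
      (raise u≤u² (loop₁ (≤-trans (≤-reflexive xs≡) S≤u) (pick-takes xs v)))
    where
    u≤u² = m≤m*n u u

  -- A positive answer serves as evidence that the list is nonempty; thus `union` preserves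
  -- nonemptiness even when it skips a duplicate.
  member-takes : ∀ x ys → Takes (member x ys) (1 + length ys * 1) 1 (λ b → b ≡ true → 1 ≤ length ys)
  member-takes x []       = op-takes λ ()
  member-takes x (y ∷ ys) = round 0 1 (length ys) (member-takes x ys ⨾ λ _ _ → op-takes λ _ → s≤s z≤n)

  union-takes : ∀ {{_ : NonZero u}} xs ys → length xs + length ys ≤ u →
                Takes (union xs ys) (1 + length xs * 3) u
                      (λ zs → length zs ≤ length xs + length ys × (1 ≤ length xs → 1 ≤ length zs))
  union-takes []       ys _ = op-takes (≤-refl , λ ())
  union-takes (x ∷ xs) ys xs+ys≤u = round 0 3 (length xs)
    (union-takes xs ys xs+ys≤u′ ⨾ λ zs (zs≤ , _) →
     loop₁ (≤-trans zs≤ xs+ys≤u′) (member-takes x zs) ⨾ λ b zs≢[] →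
     op-takes (inserted b zs zs≤ zs≢[]))
    where
    xs+ys≤u′ = ≤-trans (n≤1+n _) xs+ys≤u
    inserted : ∀ b zs → length zs ≤ length xs + length ys → (b ≡ true → 1 ≤ length zs) →
               let ws = if b then zs else x ∷ zs in
               length ws ≤ suc (length xs + length ys) × (1 ≤ suc (length xs) → 1 ≤ length ws)
    inserted true  zs zs≤ zs≢[] = m≤n⇒m≤1+n zs≤ , λ _ → zs≢[] refl
    inserted false zs zs≤ _     = s≤s zs≤ , λ _ → s≤s z≤n

  -- The constant cost of each call of `union` is charged to the list itself, so that empty lists
  -- are paid for as well; hence the summand `length xss`.
  unionAll-takes : ∀ {{_ : NonZero u}} xss → totalLength xss ≤ u →
                   Takes (unionAll xss) (1 + (length xss + totalLength xss) * 3) u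
                         (λ zs → length zs ≤ totalLength xss)
  unionAll-takes []         _ = op-takes z≤n
  unionAll-takes (xs ∷ xss) xss≤u = atMost (eq (length xss) (totalLength xss) (length xs))
    (unionAll-takes xss (≤-trans (m≤n+m _ (length xs)) xss≤u) ⨾ λ ys ys≤ →
     let xs+ys≤ = +-monoʳ-≤ (length xs) ys≤ in
     entails (λ zs (zs≤ , _) → ≤-trans zs≤ xs+ys≤) (union-takes xs ys (≤-trans xs+ys≤ xss≤u)))
    where
    rearrange : ∀ l t s → ((1 + (l + t) * 3) + (1 + s * 3)) + 2 ≡ 1 + (suc l + (s + t)) * 3
    rearrange = solve-∀
    eq : ∀ l t s → (1 + (l + t) * 3) + (1 + s * 3) ≤ 1 + (suc l + (s + t)) * 3
    eq l t s = ≤-trans (m≤m+n _ 2) (≤-reflexive (rearrange l t s))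

  -- Merging only moves elements between clusters, so the total size grows by exactly the new point.
  -- Each distance to x, and each step of appending, is charged to an element already clustered, and
  -- the constant overhead to a cluster.
  absorb-takes : ∀ τ x 𝒞 → Takes (absorb τ x 𝒞) (1 + (length 𝒞 + totalLength 𝒞) * 4) 1
                 (λ (D , 𝒟) → length D + totalLength 𝒟 ≡ suc (totalLength 𝒞) × length 𝒟 ≤ length 𝒞)
  absorb-takes τ x []      = op-takes (refl , z≤n)
  absorb-takes τ x (C ∷ 𝒞) = atMost (eq (length 𝒞) (totalLength 𝒞) (length C))
    (absorb-takes τ x 𝒞 ⨾ λ (D , 𝒟) (sizes , 𝒟≤) →
     distanceTo-takes x C ⨾ λ δ _ → tick-takes
     (if-takes (not (Supremum.[ τ ] ≤∞? δ))
       (append-takes C D ⨾ λ E E≡ → op-takes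
         ( trans (cong (_+ totalLength 𝒟) E≡) (trans (+-assoc (length C) _ _)
             (trans (cong (length C +_) sizes) (+-suc (length C) _)))
         , m≤n⇒m≤1+n 𝒟≤))
       (atMost (s≤s z≤n) (op-takes
         ( trans (swap (length D) (length C) (totalLength 𝒟))
             (trans (cong (length C +_) sizes) (+-suc (length C) _))
         , s≤s 𝒟≤)))))
    where
    swap : ∀ d c t → d + (c + t) ≡ c + (d + t)
    swap = solve-∀
    rearrange : ∀ l t s → ((1 + (l + t) * 4) + ((1 + s * 2) + suc ((1 + s * 1) + 1))) + s ≡
                          1 + (suc l + (s + t)) * 4
    rearrange = solve-∀
    eq : ∀ l t s → (1 + (l + t) * 4) + ((1 + s * 2) + suc ((1 + s * 1) + 1)) ≤
                   1 + (suc l + (s + t)) * 4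
    eq l t s = ≤-trans (m≤m+n _ s) (≤-reflexive (rearrange l t s))

  cluster-takes : ∀ {{_ : NonZero u}} τ V → length V ≤ u →
                  Takes (cluster τ V) (1 + length V * 10) u
                        (λ 𝒞 → totalLength 𝒞 ≡ length V × length 𝒞 ≤ length V)
  cluster-takes τ []      _ = op-takes (refl , z≤n)
  cluster-takes {u} τ (x ∷ V) V≤u = round 0 10 (length V)
    (cluster-takes τ V V≤u′ ⨾ λ 𝒞 (total≡ , 𝒞≤) →
     loop₂ (length 𝒞) (totalLength 𝒞) (*1-≤ (≤-trans 𝒞≤ V≤u′)) (*1-≤ (≤-trans (≤-reflexive total≡) V≤u′))
       (>-nonZero⁻¹ u) (absorb-takes τ x 𝒞) ⨾
     λ (D , 𝒟) (sizes , 𝒟≤) → op-takes (trans sizes (cong suc total≡) , s≤s (≤-trans 𝒟≤ 𝒞≤)))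
    where
    V≤u′ = ≤-trans (n≤1+n _) V≤u

  -- Every cluster is charged the full `u`, which is crude but stays within u². The exact total
  -- length identifies the size of the ground set with that of S_all.
  label-takes : ∀ {{_ : NonZero u}} 𝒞 → length 𝒞 ≤ u → totalLength 𝒞 ≤ u →
                Takes (label 𝒞) 11 (u * u) (λ xs → length xs ≡ totalLength 𝒞)
  label-takes {u} 𝒞 𝒞≤u total≤u =
    raise u≤u² (loop₁ 𝒞≤u (listToArray-takes 𝒞)) ⨾ λ { v refl →
    loop (length (allFin (length 𝒞)))
      (*-monoˡ-≤ u allFin≤u) u≤u²
      (forEach-takes′ {Q = λ j xs → length xs ≡ length (Vec.lookup v j)} (λ j → tick-takes (
        loop₁ (≤-trans (lookup≤total 𝒞 j) total≤u)
          (entails (λ xs C≈xs → sym (Pointwise-length C≈xs))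
            (forEach-takes′ {Q = λ _ _ → ⊤} (λ x → op-takes tt) (Vec.lookup v j)))))
        (allFin (length 𝒞))) ⨾ λ xss js≈xss →
    let xss≤u = ≤-trans (≤-reflexive (sym (Pointwise-length js≈xss))) allFin≤u in
    entails (λ xs xs≡ → trans xs≡ (total-lookup xss js≈xss))
      (raise u≤u² (loop₂ (length xss) (totalLength xss) (*1-≤ xss≤u)
        (*1-≤ (≤-trans (≤-reflexive (total-lookup xss js≈xss)) total≤u)) (>-nonZero⁻¹ u)
        (concatenate-takes xss))) }
    where
    u≤u² = m≤m*n u u
    allFin≤u : length (allFin (length 𝒞)) ≤ u
    allFin≤u = ≤-trans (≤-reflexive (length-tabulate {n = length 𝒞} (λ i → i))) 𝒞≤u
    lookup≤total : ∀ 𝒞 j → length (Vec.lookup (Vec.fromList 𝒞) j) ≤ totalLength 𝒞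
    lookup≤total (C ∷ 𝒞) zero    = m≤m+n _ _
    lookup≤total (C ∷ 𝒞) (suc j) = ≤-trans (lookup≤total 𝒞 j) (m≤n+m _ (length C))
    lengths : ∀ 𝒞 → tabulate (λ j → length (Vec.lookup (Vec.fromList 𝒞) j)) ≡ map length 𝒞
    lengths []      = refl
    lengths (C ∷ 𝒞) = cong (length C ∷_) (lengths 𝒞)
    total-pointwise : {f : A → ℕ} {js : List A} {xss : List (List B)} →
                      Pointwise (λ j xs → length xs ≡ f j) js xss → totalLength xss ≡ sum (map f js)
    total-pointwise []         = refl
    total-pointwise (eq ∷ eqs) = cong₂ _+_ eq (total-pointwise eqs)
    total-lookup : (xss : List (List (X × Fin (length 𝒞)))) →
                   Pointwise (λ j xs → length xs ≡ length (Vec.lookup (Vec.fromList 𝒞) j))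
                             (allFin (length 𝒞)) xss →
                   totalLength xss ≡ totalLength 𝒞
    total-lookup xss eqs =
      trans (total-pointwise eqs) (cong sum (trans (map-tabulate (λ i → i) _) (lengths 𝒞)))

  -- Matroid intersection

  module _ {c₀ : ℝ} (F : FastCunningham R c₀) {n : ℕ} (V : Vec X n) (M₁ M₂ : PartitionMatroid n)
           {u : ℕ} {{u≢0 : NonZero u}} (n≤u : n ≤ u) where
    open MatroidIntersection F V M₁ M₂

    private
      allFin≤u : length (allFin n) ≤ u
      allFin≤u = ≤-trans (≤-reflexive (length-tabulate {n = n} (λ i → i))) n≤u

    tally-takes : ∀ M S → blocks M ≤ u → Takes (tally M S) 8 u Always
    tally-takes M S blocks≤u =
      loop₁ blocks≤u (newArray-takes (blocks M)) ⨾ λ v _ →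
      loop₁ allFin≤u (accumulate-takes {Inv = Always} (λ v x _ → tick-takes (tick-takes (
        if-takes (Vec.lookup S x) (tick-takes (op-takes tt)) (atMost z≤n (return-takes tt))))) tt (allFin n))

    inV₁∩V₂-takes : ∀ S v₁ v₂ x → Takes (inV₁∩V₂ S v₁ v₂ x) 10 1 Always
    inV₁∩V₂-takes S v₁ v₂ x =
      tick-takes (tick-takes (tick-takes (tick-takes (tick-takes (tick-takes (tick-takes
        (tick-takes (tick-takes (op-takes tt)))))))))

    elements-takes : ∀ S → Takes (elements S) 6 u (λ T → length T ≤ n)
    elements-takes S =
      loop₁ allFin≤u (select-takes′ (λ x → op-takes tt) (allFin n)) ⨾ λ xs xs≤ →
      let xs≤n = ≤-trans xs≤ (≤-reflexive (length-tabulate {n = n} (λ i → i))) in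
      entails (λ T xs≈T → ≤-trans (≤-reflexive (sym (Pointwise-length xs≈T))) xs≤n)
        (loop₁ (≤-trans xs≤n n≤u) (forEach-takes′ {Q = λ _ _ → ⊤} (λ x → op-takes tt) xs))

    -- The fuel `l` counts the rounds. The list of candidates only has to stay within `u`, which
    -- keeps each round at 30 units; filtering never lengthens it.
    greedy-takes : ∀ l S v₁ v₂ cs → length cs ≤ u → Takes (greedy l S v₁ v₂ cs) (1 + l * 30) u Always
    greedy-takes l       S v₁ v₂ []       _    = atMost (s≤s z≤n) (op-takes tt)
    greedy-takes zero    S v₁ v₂ (_ ∷ _)  _    = op-takes tt
    greedy-takes (suc l) S v₁ v₂ (c ∷ cs) cs≤u =
      argmax-takes′ ⨾ λ x _ →
      let count : ∀ {blocks} → Vec ℕ blocks → Fin blocks → Vec ℕ blocks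
          count v b = v Vec.[ b ]≔ suc (Vec.lookup v b)
          S′  = S Vec.[ x ]≔ inside
          v₁′ = count v₁ (Vec.lookup (block M₁) x)
          v₂′ = count v₂ (Vec.lookup (block M₂) x)
      in
      tick-takes (tick-takes (tick-takes (tick-takes (tick-takes (tick-takes (tick-takes (
      loop₁ cs≤u (select-takes′ (λ (y , _) → inV₁∩V₂-takes S′ v₁′ v₂′ y) (c ∷ cs)) ⨾ λ ds ds≤ → tick-takes (
      loop₁ (≤-trans ds≤ cs≤u) (forEach-takes′ {Q = λ _ _ → ⊤} (λ (y , δ) →
        tick-takes (tick-takes (tick-takes (op-takes tt)))) ds) ⨾ λ ds′ ds≈ds′ →
      greedy-takes l S′ v₁′ v₂′ ds′
        (≤-trans (≤-reflexive (sym (Pointwise-length ds≈ds′))) (≤-trans ds≤ cs≤u))))))))))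
      where
      argmax-takes′ : Takes (argmax c cs) 4 u Always
      argmax-takes′ = loop₁ cs≤u (atMost (eq (length cs)) (argmax-takes c cs))
        where
        -- The surplus operation of `argmax` is charged to the head of the list, which turns the
        -- bound into a loop over `c ∷ cs`.
        eq : ∀ l → 2 + l * 2 ≤ 1 + suc l * 3
        eq l = s≤s (s≤s (≤-trans (*-monoʳ-≤ l (s≤s (s≤s z≤n))) (m≤n+m _ 2)))

    -- The unit `w` dominates u² and, by `run-takes`, an entire execution of Cunningham's loop,
    -- which therefore contributes just 1 to the coefficient 75.
    matroidIntersection-takes : ∀ {w} {{_ : NonZero w}} → u * u ≤ w → blocks M₁ ≤ u → blocks M₂ ≤ u →
                                (∀ S → Takes (FastCunningham.run F M₁ M₂ S) 1 w Always) →
                                ∀ S → Takes (matroidIntersection S) 75 w Always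
    matroidIntersection-takes u²≤w blocks₁≤u blocks₂≤u run-takes S =
      raise u≤w (tally-takes M₁ S blocks₁≤u) ⨾ λ v₁ _ →
      raise u≤w (tally-takes M₂ S blocks₂≤u) ⨾ λ v₂ _ →
      raise u≤w (loop₁ allFin≤u (select-takes′ (inV₁∩V₂-takes S v₁ v₂) (allFin n))) ⨾ λ xs xs≤ →
      let xs≤u = ≤-trans xs≤ allFin≤u in
      raise u≤w (elements-takes S) ⨾ λ T T≤n →
      loop (length xs) (≤-trans (*-monoˡ-≤ u xs≤u) u²≤w) u≤w
        (forEach-takes′ {Q = λ _ _ → ⊤} (λ x → tick-takes (
          loop₁ (≤-trans T≤n n≤u) (distanceTo-takes _ T) ⨾ λ δ _ → op-takes tt)) xs) ⨾ λ cs xs≈cs →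
      let cs≤u = ≤-trans (≤-reflexive (sym (Pointwise-length xs≈cs))) xs≤u in
      raise u≤w (loop₁ cs≤u (size-takes cs)) ⨾ λ { l refl →
      loop l (≤-trans (*-monoˡ-≤ u cs≤u) u²≤w) u≤w (greedy-takes l S v₁ v₂ cs cs≤u) ⨾ λ S′ _ →
      run-takes S′ }
      where
      u≤w = ≤-trans (m≤m*n u u) u²≤w

  -- Post-processing of all guesses

  best-takes : ∀ {c₀} (F : FastCunningham R c₀) cs → Takes (best F cs) (1 + length cs * 2) 1 Always
  best-takes F []      = op-takes tt
  best-takes F (c ∷ cs) = exactly (+-comm _ 1) (argmax-takes c cs ⨾ λ _ _ → op-takes tt)

  module _ {c₀ : ℝ} (F : FastCunningham R c₀) {u w : ℕ} (2≤k : 2 ≤ k) (1≤m : 1 ≤ m)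
           (k+mk≤u : k + m * k ≤ u) (u²≤w : u * u ≤ w)
           (run-takes : ∀ {n} (M₁ M₂ : PartitionMatroid n) → 1 ≤ n → n ≤ u →
                        (∀ S → Independent M₁ S → ∣ S ∣ ≤ k) →
                        ∀ S → Takes (FastCunningham.run F M₁ M₂ S) 1 w Always)
           where

    private
      instance
        k≢0 : NonZero k
        k≢0 = >-nonZero (≤-trans (s≤s z≤n) 2≤k)
        m≢0 : NonZero m
        m≢0 = >-nonZero 1≤m
      k≤u : k ≤ u
      k≤u = ≤-trans (m≤m+n k (m * k)) k+mk≤u
      mk≤u : m * k ≤ u
      mk≤u = ≤-trans (m≤n+m (m * k) k) k+mk≤u
      m≤u : m ≤ u
      m≤u = ≤-trans (m≤m*n m k) mk≤u
      instance
        u≢0 : NonZero u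
        u≢0 = >-nonZero (≤-trans (>-nonZero⁻¹ k) k≤u)
      u≤w : u ≤ w
      u≤w = ≤-trans (m≤m*n u u) u²≤w
      instance
        w≢0 : NonZero w
        w≢0 = >-nonZero (≤-trans (>-nonZero⁻¹ u) u≤w)

    total-toList : ∀ {n} (v : Vec (List X) n) → (∀ i → length (Vec.lookup v i) ≤ k) →
                   totalLength (Vec.toList v) ≤ n * k
    total-toList []      v≤k = z≤n
    total-toList (S ∷ v) v≤k = +-mono-≤ (v≤k zero) (total-toList v (λ i → v≤k (suc i)))

    augmentedSolution-takes : ∀ c → Bounded c → length (Candidate.whole c) ≡ k →
                              Takes (augmentedSolution F c) 145 w (λ S → length S ≤ u)
    augmentedSolution-takes record { μ = μ ; whole = S ; fair = Sᵢ } (bounded S≤k Sᵢ≤k) S≡k =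
      raise u²≤w (partialSolution-takes S S≤u m≤u) ⨾ λ S′ S′≤S →
      -- The outermost `union`, the one with S_μ, is split off from `unionAll`: S_μ is the list
      -- known to be nonempty, and its union passes this on to S_all.
      (loop₂ (length Ss) (totalLength Ss)
         (≤-trans (*-monoˡ-≤ u Ss≤u) u²≤w) (≤-trans (*-monoˡ-≤ u total≤u) u²≤w) u≤w
         (unionAll-takes Ss total≤u) ⨾ λ all₀ all₀≤ →
       let S+all₀≤u = ≤-trans (+-mono-≤ S≤k (≤-trans all₀≤ total≤mk)) k+mk≤u in
       entails (λ all (all≤ , nonempty) → ≤-trans all≤ S+all₀≤u , nonempty 1≤S)
         (loop (length S) (≤-trans (*-monoˡ-≤ u S≤u) u²≤w) u≤w
           (union-takes S all₀ S+all₀≤u))) ⨾ λ all (all≤u , 1≤all) →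
      tick-takes (
      loop (length all) (≤-trans (*-monoˡ-≤ u all≤u) u²≤w) u≤w
        (cluster-takes _ all all≤u) ⨾ λ 𝒞 (total≡ , 𝒞≤) →
      let 𝒞≤u = ≤-trans 𝒞≤ all≤u in
      raise u²≤w (label-takes 𝒞 𝒞≤u (≤-trans (≤-reflexive total≡) all≤u)) ⨾ λ lab lab≡ →
      let lab≡all = trans lab≡ total≡
          lab≤u = ≤-trans (≤-reflexive lab≡all) all≤u
          1≤lab = ≤-trans 1≤all (≤-reflexive (sym lab≡all))
      in
      raise u≤w (loop₁ lab≤u (listToArray-takes lab)) ⨾ λ arr _ →
      raise u≤w (loop₁ lab≤u (forEachᵛ-takes (λ _ → op-takes tt) arr)) ⨾ λ V _ →
      raise u≤w (loop₁ lab≤u (forEachᵛ-takes (λ _ → op-takes tt) V)) ⨾ λ g _ →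
      raise u≤w (loop₁ lab≤u (forEachᵛ-takes (λ _ → op-takes tt) arr)) ⨾ λ c _ →
      raise u≤w (loop₁ 𝒞≤u (newArray-takes (length 𝒞))) ⨾ λ one _ →
      let M₁ : PartitionMatroid (length lab)
          M₁ = record { blocks = m ; block = g ; capacity = quota }
          M₂ = record { blocks = length 𝒞 ; block = c ; capacity = one }
      in
      loop (length lab) (≤-trans (*-monoˡ-≤ u lab≤u) u²≤w) u≤w
        (forEachᵛ-takes (λ x → loop₁ (≤-trans S′≤S S≤u)
          (entails (λ _ _ → tt) (member-takes x S′))) V) ⨾ λ S₀ _ →
      matroidIntersection-takes F V M₁ M₂ lab≤u u²≤w m≤u 𝒞≤u
        -- The capacities of M₁ are the quotas, whose sum is k by definition.
        (run-takes M₁ M₂ 1≤lab lab≤u (∣independent∣≤ M₁)) S₀ ⨾ λ S″ _ →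
      entails (λ T T≤lab → ≤-trans T≤lab lab≤u) (raise u≤w (elements-takes F V M₁ M₂ lab≤u S″)))
      where
      Ss = Vec.toList Sᵢ
      S≤u = ≤-trans S≤k k≤u
      1≤S = ≤-trans (s≤s z≤n) (≤-trans 2≤k (≤-reflexive (sym S≡k)))
      Ss≤u : length Ss ≤ u
      Ss≤u = ≤-trans (≤-reflexive (Vec.length-toList Sᵢ)) m≤u
      total≤mk = total-toList Sᵢ Sᵢ≤k
      total≤u = ≤-trans total≤mk mk≤u

    -- With `suc g` in place of `g`, the unit also covers the final operation of a traversal that
    -- meets no candidate.
    postProcess-takes : ∀ {g} σ → Invariant g σ → Takes (postProcess F σ) 175 (suc g * w) Always
    postProcess-takes {g} σ (refl , σ-bounded) =
      repeat ≤-refl (select-takes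
        (λ c c-bounded → raise (≤-trans mk≤u u≤w)
          (entails (λ _ full eq → c-bounded , full eq) (eligible-takes c c-bounded)))
        σ-bounded) ⨾ λ σ′ (σ′≤ , σ′-full) →
      repeat σ′≤ (forEach-takes {Q = λ _ S → length S ≤ u}
        (λ c (c-bounded , full) → augmentedSolution-takes c c-bounded full) σ′-full) ⨾ λ Ss σ′≈Ss →
      let Ss≤ = ≤-trans (≤-reflexive (sym (Pointwise-length σ′≈Ss))) σ′≤ in
      repeat Ss≤ (select-takes
        (λ S S≤u → raise u≤w (loop₁ S≤u (size-takes S)) ⨾ λ s _ → op-takes (λ _ → S≤u))
        (allʳ σ′≈Ss)) ⨾ λ Ss′ (Ss′≤ , Ss′≤u) →
      repeat (≤-trans Ss′≤ Ss≤) (forEach-takes {Q = λ _ _ → ⊤}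
        (λ S S≤u → loop (length S) (≤-trans (*-monoˡ-≤ u S≤u) u²≤w) u≤w
          (diversity-takes S S≤u) ⨾ λ δ _ → op-takes tt)
        Ss′≤u) ⨾ λ cs Ss′≈cs →
      repeat (≤-trans (≤-reflexive (sym (Pointwise-length Ss′≈cs))) (≤-trans Ss′≤ Ss≤))
        (raise {a = 1 + length cs * 2} (>-nonZero⁻¹ w) (best-takes F cs))
      where
      repeat : ∀ {n c} {p : Comp A} {Q : A → Set} → n ≤ g →
               Takes p (1 + n * c) w Q → Takes p (1 + c) (suc g * w) Q
      repeat {n = n} n≤g = loop n (*-monoˡ-≤ w (m≤n⇒m≤1+n n≤g)) (m≤m+n w _)
      allʳ : ∀ {xs : List A} {ys : List B} {P : B → Set} → Pointwise (λ _ → P) xs ys → All P ys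
      allʳ []       = []
      allʳ (p ∷ ps) = p ∷ allʳ ps

-- Ordered-field arithmetic, rounding and the logarithm

module RealProperties (R : Reals) where
  open Reals R

  commutativeRing : CommutativeRing 0ℓ 0ℓ
  commutativeRing = record { isCommutativeRing = isCommutativeRing }

  private
    poset : Poset 0ℓ 0ℓ 0ℓ
    poset = record { isPartialOrder = IsDecTotalOrder.isPartialOrder isDecTotalOrder }

  open CommutativeRing commutativeRing using
    ( ring; commutativeSemiring; +-comm; +-assoc; *-comm; *-assoc; distribˡ; distribʳ
    ; +-identityˡ; +-identityʳ; *-identityˡ; *-identityʳ; zeroˡ; zeroʳ; -‿inverseʳ)
  open Algebra.Properties.Ring ring using (-‿distribʳ-*; x+x≈x⇒x≈0; +-cancelˡ; -‿involutive; //-rightDividesˡ)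
  open Algebra.Solver.Ring.NaturalCoefficients.Default commutativeSemiring
    using (solve; _:=_; _:+_; _:*_)
  open IsDecTotalOrder isDecTotalOrder using (antisym; total; ≤-respˡ-≈) renaming
    (refl to ≤-refl; trans to ≤-trans; reflexive to ≤-reflexive) public
  open Relation.Binary.Reasoning.PartialOrder poset public
    using (begin_; begin-equality_; step-≤; step-≡-⟩; step-≡-⟨; _∎)

  private
    variable
      x y z x′ y′ : ℝ

  +-mono-≤ : x ≤ y → x′ ≤ y′ → x + x′ ≤ y + y′
  +-mono-≤ {x} {y} {x′} {y′} x≤y x′≤y′ = begin
    x + x′ ≤⟨ +-monoˡ-≤ x′ x≤y ⟩
    y + x′ ≡⟨ +-comm y x′ ⟩
    x′ + y ≤⟨ +-monoˡ-≤ y x′≤y′ ⟩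
    y′ + y ≡⟨ +-comm y′ y ⟩
    y + y′ ∎

  +-monoʳ-≤ : ∀ z → x ≤ y → z + x ≤ z + y
  +-monoʳ-≤ z = +-mono-≤ ≤-refl

  x≤x+y : ∀ x → 0# ≤ y → x ≤ x + y
  x≤x+y {y} x 0≤y = begin
    x      ≡⟨ +-identityʳ x ⟨
    x + 0# ≤⟨ +-monoʳ-≤ x 0≤y ⟩
    x + y  ∎

  -cancel : ∀ x y → (x + - y) + y ≡ x
  -cancel x y = //-rightDividesˡ y x

  0≤y-x : x ≤ y → 0# ≤ y + - x
  0≤y-x {x} x≤y = ≤-respˡ-≈ (-‿inverseʳ x) (+-monoˡ-≤ (- x) x≤y)

  *-monoʳ-≤ : ∀ z → 0# ≤ z → x ≤ y → z * x ≤ z * y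
  *-monoʳ-≤ {x} {y} z 0≤z x≤y = begin
    z * x                   ≡⟨ +-identityˡ _ ⟨
    0# + z * x              ≤⟨ +-monoˡ-≤ (z * x) (*-nonNegative 0≤z (0≤y-x x≤y)) ⟩
    z * (y + - x) + z * x   ≡⟨ distribˡ z _ _ ⟨
    z * ((y + - x) + x)     ≡⟨ cong (z *_) (-cancel y x) ⟩
    z * y                   ∎

  *-monoˡ-≤ : ∀ z → 0# ≤ z → x ≤ y → x * z ≤ y * z
  *-monoˡ-≤ z 0≤z x≤y = subst₂ _≤_ (*-comm z _) (*-comm z _) (*-monoʳ-≤ z 0≤z x≤y)

  *-mono-≤ : 0# ≤ x′ → 0# ≤ y → x ≤ y → x′ ≤ y′ → x * x′ ≤ y * y′
  *-mono-≤ 0≤x′ 0≤y x≤y x′≤y′ = ≤-trans (*-monoˡ-≤ _ 0≤x′ x≤y) (*-monoʳ-≤ _ 0≤y x′≤y′)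

  0≤1 : 0# ≤ 1#
  0≤1 with total 0# 1#
  ... | inj₁ 0≤1 = 0≤1
  ... | inj₂ 1≤0 = subst (0# ≤_) -1*-1≡1 (*-nonNegative 0≤-1 0≤-1)
    where
    0≤-1 : 0# ≤ - 1#
    0≤-1 = subst (0# ≤_) (+-identityˡ _) (0≤y-x 1≤0)
    -1*-1≡1 : - 1# * - 1# ≡ 1#
    -1*-1≡1 = trans (sym (-‿distribʳ-* (- 1#) 1#)) (trans (cong -_ (*-identityʳ _)) (-‿involutive 1#))

  1≰0 : ¬ 1# ≤ 0#
  1≰0 1≤0 = 0≢1 (antisym 0≤1 1≤0)

  0<1 : 0# < 1#
  0<1 = 0≤1 , 0≢1

  <-≤-trans : x < y → y ≤ z → x < z
  <-≤-trans (x≤y , x≢y) y≤z = ≤-trans x≤y y≤z , λ { refl → x≢y (antisym x≤y y≤z) }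

  *-inverseˡ : 0# < x → x ⁻¹ * x ≡ 1#
  *-inverseˡ {x} (_ , 0≢x) = trans (*-comm _ x) (*-inverseʳ x (λ x≡0 → 0≢x (sym x≡0)))

  0<x⁻¹ : 0# < x → 0# < x ⁻¹
  0<x⁻¹ {x} 0<x@(0≤x , _) with total 0# (x ⁻¹)
  ... | inj₁ 0≤x⁻¹ = 0≤x⁻¹ , λ 0≡x⁻¹ →
    0≢1 (trans (sym (zeroˡ x)) (trans (cong (_* x) 0≡x⁻¹) (*-inverseˡ 0<x)))
  ... | inj₂ x⁻¹≤0 = contradiction (subst₂ _≤_ (*-inverseˡ 0<x) (zeroˡ x) (*-monoˡ-≤ x 0≤x x⁻¹≤0)) 1≰0

  0<x*y : 0# < x → 0# < y → 0# < x * y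
  0<x*y {x} {y} 0<x (0≤y , 0≢y) = *-nonNegative (proj₁ 0<x) 0≤y , λ 0≡xy → 0≢y (begin-equality
    0#               ≡⟨ zeroʳ (x ⁻¹) ⟨
    x ⁻¹ * 0#        ≡⟨ cong (x ⁻¹ *_) 0≡xy ⟩
    x ⁻¹ * (x * y)   ≡⟨ *-assoc _ x y ⟨
    x ⁻¹ * x * y     ≡⟨ cong (_* y) (*-inverseˡ 0<x) ⟩
    1# * y           ≡⟨ *-identityˡ y ⟩
    y                ∎)

  0<x^n : 0# < x → ∀ n → 0# < x ^ n
  0<x^n 0<x zero    = 0<1
  0<x^n 0<x (suc n) = 0<x*y 0<x (0<x^n 0<x n)

  0≤ι : ∀ n → 0# ≤ ι n
  0≤ι zero    = ≤-refl
  0≤ι (suc n) = ≤-trans 0≤1 (x≤x+y 1# (0≤ι n))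

  ι-mono-≤ : ∀ {m n} → m ℕ.≤ n → ι m ≤ ι n
  ι-mono-≤ {n = n} ℕ.z≤n = 0≤ι n
  ι-mono-≤ (ℕ.s≤s m≤n)   = +-monoʳ-≤ 1# (ι-mono-≤ m≤n)

  -- Otherwise n + 1 ≤ m, and 1 ≤ 0 would follow. This brings bounds proved in ℝ back to exponents
  -- and step counts.
  ι-cancel-≤ : ∀ {m n} → ι m ≤ ι n → m ℕ.≤ n
  ι-cancel-≤ {m} {n} ιm≤ιn with m ℕ.≤? n
  ... | yes m≤n = m≤n
  ... | no m≰n  = contradiction (begin
    1#                 ≡⟨ +-identityʳ 1# ⟨
    1# + 0#            ≡⟨ cong (1# +_) (-‿inverseʳ (ι n)) ⟨
    1# + (ι n + - ι n) ≡⟨ +-assoc 1# _ _ ⟨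
    1# + ι n + - ι n   ≤⟨ +-monoˡ-≤ (- ι n) (≤-trans (ι-mono-≤ (ℕ.≰⇒> m≰n)) ιm≤ιn) ⟩
    ι n + - ι n        ≡⟨ -‿inverseʳ (ι n) ⟩
    0#                 ∎) 1≰0

  ι-+ : ∀ m n → ι (m ℕ.+ n) ≡ ι m + ι n
  ι-+ zero    n = sym (+-identityˡ _)
  ι-+ (suc m) n = trans (cong (1# +_) (ι-+ m n)) (sym (+-assoc 1# _ _))

  ι-* : ∀ m n → ι (m ℕ.* n) ≡ ι m * ι n
  ι-* zero    n = sym (zeroˡ _)
  ι-* (suc m) n = begin-equality
    ι (n ℕ.+ m ℕ.* n)    ≡⟨ ι-+ n (m ℕ.* n) ⟩
    ι n + ι (m ℕ.* n)    ≡⟨ cong₂ _+_ (sym (*-identityˡ _)) (ι-* m n) ⟩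
    1# * ι n + ι m * ι n ≡⟨ distribʳ (ι n) 1# (ι m) ⟨
    (1# + ι m) * ι n     ∎

  -- Descent from an archimedean bound: as long as the predecessor still bounds x, the search moves
  -- on to it. Rounding a real bound to a step count thus costs at most 1.
  ceiling : ∀ x → 0# ≤ x → ∃[ n ] x ≤ ι n × ι n ≤ x + 1#
  ceiling x 0≤x = go (proj₁ (archimedean x)) (proj₂ (archimedean x))
    where
    go : ∀ n → x ≤ ι n → ∃[ n ] x ≤ ι n × ι n ≤ x + 1#
    go zero    x≤ι = 0 , x≤ι , ≤-trans 0≤x (x≤x+y x 0≤1)
    go (suc n) x≤ι with x ≤? ι n | total x (ι n)
    ... | yes x≤ιn | _         = go n x≤ιn
    ... | no x≰ιn  | inj₁ x≤ιn = contradiction x≤ιn x≰ιn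
    ... | no _     | inj₂ ιn≤x = suc n , x≤ι , ≤-respˡ-≈ (+-comm (ι n) 1#) (+-monoˡ-≤ 1# ιn≤x)

  bernoulli : ∀ n → 0# ≤ x → 1# + ι n * x ≤ (1# + x) ^ n
  bernoulli {x} zero    0≤x = ≤-reflexive (trans (cong (1# +_) (zeroˡ x)) (+-identityʳ 1#))
  bernoulli {x} (suc n) 0≤x = begin
    1# + (1# + ι n) * x                    ≡⟨ cong (1# +_) (trans (distribʳ x 1# (ι n))
                                                (cong (_+ ι n * x) (*-identityˡ x))) ⟩
    1# + (x + ι n * x)                     ≡⟨ solve 3 (λ a x y → a :+ (x :+ y) := (a :+ y) :+ x) refl 1# x (ι n * x) ⟩
    1# + ι n * x + x                       ≤⟨ +-monoʳ-≤ (1# + ι n * x) x≤ ⟩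
    1# + ι n * x + x * (1# + ι n * x)      ≡⟨ cong (_+ x * (1# + ι n * x)) (*-identityˡ _) ⟨
    1# * (1# + ι n * x) + x * (1# + ι n * x) ≡⟨ distribʳ _ 1# x ⟨
    (1# + x) * (1# + ι n * x)              ≤⟨ *-monoʳ-≤ (1# + x) (≤-trans 0≤1 (x≤x+y 1# 0≤x)) (bernoulli n 0≤x) ⟩
    (1# + x) * (1# + x) ^ n                ∎
    where
    x≤ : x ≤ x * (1# + ι n * x)
    x≤ = ≤-respˡ-≈ (*-identityʳ x) (*-monoʳ-≤ x 0≤x (x≤x+y 1# (*-nonNegative (0≤ι n) 0≤x)))

  log-1 : log 1# ≡ 0#
  log-1 = x+x≈x⇒x≈0 (log 1#) (trans (sym (log-* 0<1 0<1)) (cong log (*-identityˡ 1#)))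

  log-^ : 0# < x → ∀ n → log (x ^ n) ≡ ι n * log x
  log-^ {x} 0<x zero    = trans log-1 (sym (zeroˡ _))
  log-^ {x} 0<x (suc n) = trans (log-* 0<x (0<x^n 0<x n)) (trans (cong₂ _+_ (sym (*-identityˡ _)) (log-^ 0<x n))
                                                                (sym (distribʳ (log x) 1# (ι n))))

  log-⁻¹ : 0# < x → log x + log (x ⁻¹) ≡ 0#
  log-⁻¹ {x} 0<x = trans (sym (log-* 0<x (0<x⁻¹ 0<x)))
                         (trans (cong log (trans (*-comm x _) (*-inverseˡ 0<x))) log-1)

  0≤log : 1# ≤ x → 0# ≤ log x
  0≤log 1≤x = ≤-respˡ-≈ log-1 (log-mono-≤ 0<1 1≤x)

  -- With n = ⌈1/x⌉, Bernoulli gives 2 ≤ 1 + n x ≤ (1 + x)ⁿ, so 1 ≤ n log (1 + x),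
  -- while n x ≤ 1 + x.
  x≤[1+x]log[1+x] : 0# < x → x ≤ (1# + x) * log (1# + x)
  x≤[1+x]log[1+x] {x} 0<x@(0≤x , _) with n , x⁻¹≤n , n≤x⁻¹+1 ← ceiling (x ⁻¹) (proj₁ (0<x⁻¹ 0<x)) = begin
    x                      ≡⟨ *-identityʳ x ⟨
    x * 1#                 ≤⟨ *-monoʳ-≤ x 0≤x 1≤nℓ ⟩
    x * (ι n * ℓ)          ≡⟨ solve 3 (λ x n l → x :* (n :* l) := (n :* x) :* l) refl x (ι n) ℓ ⟩
    (ι n * x) * ℓ          ≤⟨ *-monoˡ-≤ ℓ (0≤log (x≤x+y 1# 0≤x)) nx≤1+x ⟩
    (1# + x) * ℓ           ∎
    where
    ℓ = log (1# + x)
    1≤nx : 1# ≤ ι n * x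
    1≤nx = ≤-respˡ-≈ (*-inverseˡ 0<x) (*-monoˡ-≤ x 0≤x x⁻¹≤n)
    nx≤1+x : ι n * x ≤ 1# + x
    nx≤1+x = begin
      ι n * x             ≤⟨ *-monoˡ-≤ x 0≤x n≤x⁻¹+1 ⟩
      (x ⁻¹ + 1#) * x     ≡⟨ distribʳ x (x ⁻¹) 1# ⟩
      x ⁻¹ * x + 1# * x   ≡⟨ cong₂ _+_ (*-inverseˡ 0<x) (*-identityˡ x) ⟩
      1# + x              ∎
    0<1+x : 0# < 1# + x
    0<1+x = <-≤-trans 0<1 (x≤x+y 1# 0≤x)
    1≤nℓ : 1# ≤ ι n * ℓ
    1≤nℓ = begin
      1#                   ≡⟨ log-2 ⟨
      log (1# + 1#)        ≤⟨ log-mono-≤ (<-≤-trans 0<1 (x≤x+y 1# 0≤1))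
                                (≤-trans (+-monoʳ-≤ 1# 1≤nx) (bernoulli n 0≤x)) ⟩
      log ((1# + x) ^ n)   ≡⟨ log-^ 0<1+x n ⟩
      ι n * ℓ              ∎

  -- Monotonicity is assumed only in its weak form. Strictness comes from `x≤[1+x]log[1+x]` at δ = x
  -- - 1: a vanishing logarithm would force δ ≤ 0.
  0<log : 1# < x → 0# < log x
  0<log {x} (1≤x , 1≢x) = 0≤log 1≤x , λ 0≡log → 0≢δ (antisym 0≤δ (begin
    δ                      ≤⟨ x≤[1+x]log[1+x] (0≤δ , 0≢δ) ⟩
    (1# + δ) * log (1# + δ) ≡⟨ cong ((1# + δ) *_) (trans (cong log 1+δ≡x) (sym 0≡log)) ⟩
    (1# + δ) * 0#          ≡⟨ zeroʳ _ ⟩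
    0#                     ∎))
    where
    δ = x + - 1#
    0≤δ = 0≤y-x 1≤x
    1+δ≡x : 1# + δ ≡ x
    1+δ≡x = trans (+-comm 1# δ) (-cancel x 1#)
    0≢δ : 0# ≢ δ
    0≢δ 0≡δ = 1≢x (trans (sym (+-identityʳ 1#)) (trans (cong (1# +_) 0≡δ) 1+δ≡x))

  module _ {ε : ℝ} (0<ε : 0# < ε) (ε<1 : ε < 1#) where

    0<1-ε : 0# < 1# + - ε
    0<1-ε = 0≤y-x (proj₁ ε<1) , λ 0≡ → proj₂ ε<1
      (trans (sym (+-identityˡ ε)) (trans (cong (_+ ε) 0≡) (-cancel 1# ε)))

    -- This is `x≤[1+x]log[1+x]` at x = ε / (1 - ε), where 1 + x = 1 / (1 - ε), multiplied by 1 - ε.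
    ε≤log[1-ε]⁻¹ : ε ≤ log ((1# + - ε) ⁻¹)
    ε≤log[1-ε]⁻¹ = begin
      ε                          ≡⟨ *-identityʳ ε ⟨
      ε * 1#                     ≡⟨ cong (ε *_) (*-inverseˡ 0<1-ε) ⟨
      ε * (r ⁻¹ * r)             ≡⟨ *-assoc ε _ r ⟨
      ε * r ⁻¹ * r               ≤⟨ *-monoˡ-≤ r (proj₁ 0<1-ε) (x≤[1+x]log[1+x] (0<x*y 0<ε (0<x⁻¹ 0<1-ε))) ⟩
      (1# + ε * r ⁻¹) * log (1# + ε * r ⁻¹) * r ≡⟨ cong (λ x → x * log x * r) 1+εr⁻¹≡r⁻¹ ⟩
      r ⁻¹ * ℓ * r               ≡⟨ solve 3 (λ s l r → (s :* l) :* r := (s :* r) :* l) refl (r ⁻¹) ℓ r ⟩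
      r ⁻¹ * r * ℓ               ≡⟨ cong (_* ℓ) (*-inverseˡ 0<1-ε) ⟩
      1# * ℓ                     ≡⟨ *-identityˡ ℓ ⟩
      ℓ                          ∎
      where
      r = 1# + - ε
      ℓ = log (r ⁻¹)
      1+εr⁻¹≡r⁻¹ : 1# + ε * r ⁻¹ ≡ r ⁻¹
      1+εr⁻¹≡r⁻¹ = trans (cong (_+ ε * r ⁻¹) (trans (sym (*-inverseˡ 0<1-ε)) (*-comm _ r)))
                   (trans (sym (distribʳ (r ⁻¹) r ε))
                   (trans (cong (_* r ⁻¹) (-cancel 1# ε)) (*-identityˡ _)))

    exponent≤ : ∀ {dmin dmax} j → 0# < dmin → dmin * ((1# + - ε) ^ j) ⁻¹ ≤ dmax →
                ι j ≤ log (dmax * dmin ⁻¹) * ε ⁻¹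
    exponent≤ {dmin} {dmax} j 0<dmin guess≤dmax = begin
      ι j                           ≡⟨ *-identityʳ _ ⟨
      ι j * 1#                      ≡⟨ cong (ι j *_) (trans (sym (*-inverseˡ 0<ε)) (*-comm _ ε)) ⟩
      ι j * (ε * ε ⁻¹)              ≡⟨ *-assoc _ ε _ ⟨
      ι j * ε * ε ⁻¹                ≤⟨ *-monoˡ-≤ (ε ⁻¹) (proj₁ (0<x⁻¹ 0<ε)) jε≤ ⟩
      log (dmax * dmin ⁻¹) * ε ⁻¹   ∎
      where
      r = 1# + - ε
      s = (r ^ j) ⁻¹
      log-s : log s ≡ ι j * log (r ⁻¹)
      -- Both sides are additive inverses of j log r.
      log-s = +-cancelˡ (ι j * log r) _ _ (trans
        (trans (cong (_+ log s) (sym (log-^ 0<1-ε j))) (log-⁻¹ (0<x^n 0<1-ε j)))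
        (sym (trans (sym (distribˡ (ι j) _ _)) (trans (cong (ι j *_) (log-⁻¹ 0<1-ε)) (zeroʳ _)))))
      s≤Δ : s ≤ dmax * dmin ⁻¹
      s≤Δ = begin
        s                       ≡⟨ *-identityʳ s ⟨
        s * 1#                  ≡⟨ cong (s *_) (*-inverseˡ 0<dmin) ⟨
        s * (dmin ⁻¹ * dmin)    ≡⟨ solve 3 (λ s e d → s :* (e :* d) := (d :* s) :* e) refl s (dmin ⁻¹) dmin ⟩
        dmin * s * dmin ⁻¹      ≤⟨ *-monoˡ-≤ (dmin ⁻¹) (proj₁ (0<x⁻¹ 0<dmin)) guess≤dmax ⟩
        dmax * dmin ⁻¹          ∎
      jε≤ : ι j * ε ≤ log (dmax * dmin ⁻¹)
      jε≤ = begin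
        ι j * ε                 ≤⟨ *-monoʳ-≤ (ι j) (0≤ι j) ε≤log[1-ε]⁻¹ ⟩
        ι j * log (r ⁻¹)        ≡⟨ log-s ⟨
        log s                   ≤⟨ log-mono-≤ (0<x⁻¹ (0<x^n 0<1-ε j)) s≤Δ ⟩
        log (dmax * dmin ⁻¹)    ∎

-- The number of guesses

lookup-injective : ∀ {A : Set} {xs : List A} → Unique xs → ∀ {i j} → lookup xs i ≡ lookup xs j → i ≡ j
lookup-injective (_ ∷ _)     {zero}  {zero}  _  = refl
lookup-injective (x≢xs ∷ _)  {zero}  {suc j} eq = contradiction eq (All.lookup x≢xs (∈-lookup j))
lookup-injective (x≢xs ∷ _)  {suc i} {zero}  eq = contradiction (sym eq) (All.lookup x≢xs (∈-lookup i))
lookup-injective (_ ∷ xs!)   {suc i} {suc j} eq = cong suc (lookup-injective xs! eq)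

n≤sum : ∀ {n} (v : Vec ℕ n) → (∀ i → 1 ℕ.≤ Vec.lookup v i) → n ℕ.≤ Vec.sum v
n≤sum []      _   = ℕ.z≤n
n≤sum (x ∷ v) 1≤v = ℕ.+-mono-≤ (1≤v zero) (n≤sum v (1≤v ∘ suc))

module Guesses (R : Reals) (I : Input R) where
  open Reals R
  open RealProperties R
  open Input I
  open SFDM2 R I

  0<dmin : 0# < dmin
  0<dmin with x , y , x≢y , refl ← dmin-attained =
    nonNegative _ _ , λ 0≡d → x≢y (point-injective (Equivalence.to (dist≡0 _ _) (sym 0≡d)))

  -- Sending each entry of `U` to its exponent is injective, because the exponent determines the
  -- guess and `U` has no repetitions. The exponents range over 0, ..., n, whence `suc n`.
  ∣guesses∣≤ : ∀ {U} → EnumeratesGuesses U → ∀ {n} → log Δ * ε ⁻¹ ≤ ι n → length U ℕ.≤ suc n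
  ∣guesses∣≤ {U} (U! , U-guesses) {n} G≤n =
    Fin.injective⇒≤ {f = λ i → fromℕ< (ℕ.s≤s (exponent≤n i))} λ {i} {j} eq →
    lookup-injective U! (trans (proj₂ (guess i)) (trans
      (cong (λ j → dmin * ((1# + - ε) ^ j) ⁻¹) (Fin.fromℕ<-injective _ _ _ _ eq)) (sym (proj₂ (guess j)))))
    where
    isGuess : ∀ i → IsGuess (lookup U i)
    isGuess i = Equivalence.to (U-guesses _) (∈-lookup i)
    guess : ∀ i → ∃[ j ] lookup U i ≡ dmin * ((1# + - ε) ^ j) ⁻¹
    guess i = proj₁ (isGuess i)
    exponent≤n : ∀ i → proj₁ (guess i) ℕ.≤ n
    exponent≤n i = ι-cancel-≤ (≤-trans (exponent≤ 0<ε ε<1 (proj₁ (guess i)) 0<dmin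
      (≤-trans (≤-reflexive (sym (proj₂ (guess i)))) (proj₂ (proj₂ (isGuess i))))) G≤n)

-- The constant and the passage to real bounds

module Bounds (R : Reals) (Δ₀ c₀ : Reals.ℝ R) (1<Δ₀ : Reals._<_ R (Reals.1# R) Δ₀) where
  open Reals R
  open RealProperties R
  open CommutativeRing commutativeRing using
    (commutativeSemiring; *-assoc; distribʳ; +-identityʳ; *-identityˡ; *-identityʳ)
  open Algebra.Solver.Ring.NaturalCoefficients.Default commutativeSemiring
    using (Polynomial; solve; _:=_; _:+_; _:*_; con)

  private
    -- The solver evaluates this polynomial to `ι` of the numeral by computation, so that solved
    -- equations can mention `ι 2`, `ι 3` and `ι 5`.
    num : ∀ {n} → ℕ → Polynomial n
    num zero    = con 0
    num (suc n) = con 1 :+ num n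

  -- D * G bounds the number of guesses plus one.
  D : ℝ
  D = 1# + ι 3 * (log Δ₀) ⁻¹

  private
    0≤[logΔ₀]⁻¹ : 0# ≤ (log Δ₀) ⁻¹
    0≤[logΔ₀]⁻¹ = proj₁ (0<x⁻¹ (0<log 1<Δ₀))

    -- The sign of c₀ is not prescribed, whereas monotonicity of products and rounding up require a
    -- nonnegative factor.
    positivePart : ∃[ c ] 0# ≤ c × c₀ ≤ c
    positivePart with total 0# c₀
    ... | inj₁ 0≤c₀ = c₀ , 0≤c₀ , ≤-refl
    ... | inj₂ c₀≤0 = 0# , ≤-refl , c₀≤0

  c⁺ : ℝ
  c⁺ = proj₁ positivePart

  0≤c⁺ : 0# ≤ c⁺
  0≤c⁺ = proj₁ (proj₂ positivePart)

  c₀≤c⁺ : c₀ ≤ c⁺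
  c₀≤c⁺ = proj₂ (proj₂ positivePart)

  -- 175 is the coefficient in postProcess-takes, the largest of the three.
  E C : ℝ
  E = ι 5 + ι 2 * c⁺
  C = ι 175 * (D * E)

  ι5≤E : ι 5 ≤ E
  ι5≤E = x≤x+y (ι 5) (*-nonNegative (0≤ι 2) 0≤c⁺)

  module _ {Δ ε} (Δ₀≤Δ : Δ₀ ≤ Δ) (0<ε : 0# < ε) (ε<1 : ε < 1#) where

    G : ℝ
    G = log Δ * ε ⁻¹

    private
      logΔ₀≤G : log Δ₀ ≤ G
      logΔ₀≤G = begin
        log Δ₀          ≤⟨ log-mono-≤ (<-≤-trans 0<1 (proj₁ 1<Δ₀)) Δ₀≤Δ ⟩
        log Δ           ≡⟨ *-identityʳ _ ⟨
        log Δ * 1#      ≤⟨ *-monoʳ-≤ (log Δ) (0≤log (≤-trans (proj₁ 1<Δ₀) Δ₀≤Δ)) 1≤ε⁻¹ ⟩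
        log Δ * ε ⁻¹    ∎
        where
        1≤ε⁻¹ : 1# ≤ ε ⁻¹
        1≤ε⁻¹ = begin
          1#          ≡⟨ *-inverseˡ 0<ε ⟨
          ε ⁻¹ * ε    ≤⟨ *-monoʳ-≤ (ε ⁻¹) (proj₁ (0<x⁻¹ 0<ε)) (proj₁ ε<1) ⟩
          ε ⁻¹ * 1#   ≡⟨ *-identityʳ _ ⟩
          ε ⁻¹        ∎

    0≤G : 0# ≤ G
    0≤G = ≤-trans (0≤log (proj₁ 1<Δ₀)) logΔ₀≤G

    -- The excess 3 over G stems from rounding up, from the exponent 0 and from the extra 1 in
    -- `suc g`. It is at most 3 G / log Δ₀, since G ≥ log Δ₀.
    ι[2+n]≤DG : ∀ {n} → ι n ≤ G + 1# → ι (2 ℕ.+ n) ≤ D * G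
    ι[2+n]≤DG {n} n≤G+1 = begin
      1# + (1# + ι n)                 ≤⟨ +-monoʳ-≤ 1# (+-monoʳ-≤ 1# n≤G+1) ⟩
      1# + (1# + (G + 1#))            ≡⟨ solve 1 (λ g → con 1 :+ (con 1 :+ (g :+ con 1)) := g :+ num 3) refl G ⟩
      G + ι 3                         ≡⟨ cong (G +_) (*-identityʳ (ι 3)) ⟨
      G + ι 3 * 1#                    ≤⟨ +-monoʳ-≤ G (*-monoʳ-≤ (ι 3) (0≤ι 3) 1≤) ⟩
      G + ι 3 * ((log Δ₀) ⁻¹ * G)     ≡⟨ cong₂ _+_ (*-identityˡ G) (*-assoc (ι 3) _ G) ⟨
      1# * G + ι 3 * (log Δ₀) ⁻¹ * G  ≡⟨ distribʳ G 1# _ ⟨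
      D * G                           ∎
      where
      1≤ : 1# ≤ (log Δ₀) ⁻¹ * G
      1≤ = ≤-respˡ-≈ (*-inverseˡ (0<log 1<Δ₀)) (*-monoʳ-≤ _ 0≤[logΔ₀]⁻¹ logΔ₀≤G)

    0≤DG : 0# ≤ D * G
    0≤DG = *-nonNegative (≤-trans 0≤1 (x≤x+y 1# (*-nonNegative (0≤ι 3) 0≤[logΔ₀]⁻¹))) 0≤G

    -- Lets one constant serve all three claims: `a` is a step coefficient, `h` the number of
    -- guesses plus one, `z` the cost of a guess and Z the corresponding expression in k and m.
    scaled : ∀ {t a h z Z} → t ℕ.≤ a ℕ.* (h ℕ.* z) → a ℕ.≤ 175 → ι h ≤ D * G → ι z ≤ E * Z →
             ι t ≤ C * (G * Z)
    scaled {t} {a} {h} {z} {Z} t≤ a≤175 h≤ z≤ = begin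
      ι t                           ≤⟨ ι-mono-≤ (ℕ.≤-trans t≤ (ℕ.*-monoˡ-≤ (h ℕ.* z) a≤175)) ⟩
      ι (175 ℕ.* (h ℕ.* z))         ≡⟨ trans (ι-* 175 (h ℕ.* z)) (cong (ι 175 *_) (ι-* h z)) ⟩
      ι 175 * (ι h * ι z)           ≤⟨ *-monoʳ-≤ (ι 175) (0≤ι 175) (*-mono-≤ (0≤ι z) 0≤DG h≤ z≤) ⟩
      ι 175 * (D * G * (E * Z))     ≡⟨ rearrange (ι 175) D G E Z ⟩
      C * (G * Z)                   ∎
      where
      rearrange : ∀ a d g e z → a * (d * g * (e * z)) ≡ a * (d * e) * (g * z)
      rearrange = solve 5 (λ a d g e z → a :* (d :* g :* (e :* z)) := a :* (d :* e) :* (g :* z)) refl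

  -- The multiple of K²M(5ℓ + 2c⁺M) added below completes the sum to a multiple of M + ℓ.
  guess-cost≤ : ∀ k m T → 1 ℕ.≤ k → 1 ℕ.≤ m →
                let u = 2 ℕ.* (k ℕ.* m) ; ℓ = log (ι k) ^ 2 in
                ι T ≤ c⁺ * (ι u * ι k * ℓ) + 1# → 0# ≤ ℓ →
                ι (u ℕ.* u ℕ.+ T) ≤ E * (ι k ^ 2 * ι m * (ι m + ℓ))
  guess-cost≤ k m T 1≤k 1≤m T≤ 0≤ℓ = begin
    ι (u ℕ.* u ℕ.+ T)
      ≡⟨ trans (ι-+ (u ℕ.* u) T) (cong (_+ ι T) (trans (ι-* u u) (cong₂ _*_ ιu ιu))) ⟩
    ι 2 * (K * M) * (ι 2 * (K * M)) + ι T
      ≤⟨ +-monoʳ-≤ _ (≤-trans T≤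
           (+-mono-≤ (≤-reflexive (cong (λ v → c⁺ * (v * K * ℓ)) ιu)) 1≤KKMM)) ⟩
    -- Origin of `E`: u² gives 4 K²M² and the rounding of ρ at most one more K²M², hence 5; the loop
    -- gives c⁺ u K ℓ = 2 c⁺ K²Mℓ.
    ι 2 * (K * M) * (ι 2 * (K * M)) + (c⁺ * (ι 2 * (K * M) * K * ℓ) + K * K * M * M)
      ≤⟨ x≤x+y _ (*-nonNegative (*-nonNegative (*-nonNegative (0≤ι k) (0≤ι k)) (0≤ι m))
           (+-nonNegative (*-nonNegative (0≤ι 5) 0≤ℓ)
             (*-nonNegative (*-nonNegative (0≤ι 2) 0≤c⁺) (0≤ι m)))) ⟩
    ι 2 * (K * M) * (ι 2 * (K * M)) + (c⁺ * (ι 2 * (K * M) * K * ℓ) + K * K * M * M) +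
      K * K * M * (ι 5 * ℓ + ι 2 * c⁺ * M)
      ≡⟨ rearrange K M c⁺ ℓ ⟩
    E * (K * K * M * (M + ℓ))
      ≡⟨ cong (λ x → E * (K * x * M * (M + ℓ))) (*-identityʳ K) ⟨
    E * (K ^ 2 * M * (M + ℓ)) ∎
    where
    u = 2 ℕ.* (k ℕ.* m)
    K = ι k
    M = ι m
    ℓ = log (ι k) ^ 2
    ιu : ι u ≡ ι 2 * (K * M)
    ιu = trans (ι-* 2 (k ℕ.* m)) (cong (ι 2 *_) (ι-* k m))
    +-nonNegative : ∀ {x y} → 0# ≤ x → 0# ≤ y → 0# ≤ x + y
    +-nonNegative 0≤x 0≤y = ≤-trans 0≤x (x≤x+y _ 0≤y)
    1≤KKMM : 1# ≤ K * K * M * M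
    1≤KKMM = begin
      1#                               ≡⟨ +-identityʳ 1# ⟨
      ι 1                              ≤⟨ ι-mono-≤ (ℕ.*-mono-≤ (ℕ.*-mono-≤ (ℕ.*-mono-≤ 1≤k 1≤k) 1≤m) 1≤m) ⟩
      ι (k ℕ.* k ℕ.* m ℕ.* m)          ≡⟨ ι-* (k ℕ.* k ℕ.* m) m ⟩
      ι (k ℕ.* k ℕ.* m) * M            ≡⟨ cong (_* M) (ι-* (k ℕ.* k) m) ⟩
      ι (k ℕ.* k) * M * M              ≡⟨ cong (λ x → x * M * M) (ι-* k k) ⟩
      K * K * M * M                    ∎
    rearrange : ∀ K M c ℓ →
                ι 2 * (K * M) * (ι 2 * (K * M)) + (c * (ι 2 * (K * M) * K * ℓ) + K * K * M * M) +
                  K * K * M * (ι 5 * ℓ + ι 2 * c * M) ≡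
                (ι 5 + ι 2 * c) * (K * K * M * (M + ℓ))
    rearrange = solve 4 (λ K M c ℓ →
      num 2 :* (K :* M) :* (num 2 :* (K :* M)) :+ (c :* (num 2 :* (K :* M) :* K :* ℓ) :+ K :* K :* M :* M) :+
        K :* K :* M :* (num 5 :* ℓ :+ num 2 :* c :* M) :=
      (num 5 :+ num 2 :* c) :* (K :* K :* M :* (M :+ ℓ))) refl

-- The three resource bounds

theorem5 : (R : Reals) → let open Reals R in
    (Δ₀ c₀ : ℝ) → 1# < Δ₀ →
    Σ ℝ λ C →
    (I : Input R) → let open Input I in let open SFDM2 R I in
    Δ₀ ≤ Δ →
    (F : FastCunningham R c₀) →
    (U : List ℝ) → EnumeratesGuesses U →
    (stream : List X) → stream ↭ allFin card →
    (∀ ys zs σ t → stream ≡ ys ++ zs → consume ys (initial U) ⇓ σ after t →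
    ι (stored σ) ≤ C * (ι k * ι m * log Δ * ε ⁻¹))
    ×
    (∀ ys x zs σ σ′ s t → stream ≡ ys ++ x ∷ zs →
    consume ys (initial U) ⇓ σ after s → arrive x σ ⇓ σ′ after t →
    ι t ≤ C * (ι k * log Δ * ε ⁻¹))
    ×
    (∀ σ s result t → consume stream (initial U) ⇓ σ after s →
    postProcess F σ ⇓ result after t →
    ι t ≤ C * (ι k ^ 2 * ι m * log Δ * ε ⁻¹ * (ι m + log (ι k) ^ 2)))
theorem5 R Δ₀ c₀ 1<Δ₀ = C , λ I Δ₀≤Δ F U U-guesses stream _ →
  let open Resources I Δ₀≤Δ F U U-guesses in
  (λ ys zs σ t _ e → storage (invariant ys e)) ,
  (λ ys x zs σ σ′ s t _ e e′ → arrivalTime x (invariant ys e) e′) ,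
  (λ σ s result t e e′ → postProcessingTime (invariant stream e) e′)
  where
  open Reals R
  open RealProperties R
  open Bounds R Δ₀ c₀ 1<Δ₀
  open CommutativeRing commutativeRing using (commutativeSemiring)
  open Algebra.Solver.Ring.NaturalCoefficients.Default commutativeSemiring
    using (solve; _:=_; _:*_)

  module Resources (I : Input R) (Δ₀≤Δ : Δ₀ ≤ Input.Δ I) (F : FastCunningham R c₀)
                   (U : List ℝ) (U-guesses : SFDM2.EnumeratesGuesses R I U) where
    open Input I
    open SFDM2 R I
    open Computations
    open RunningTimes R I
    open Guesses R I

    g : ℕ
    g = length U

    m≤k : m ℕ.≤ k
    m≤k = n≤sum quota quota-positive

    -- Makes r = k admissible in `fast`, which is stated for r ≥ 2.
    2≤k : 2 ℕ.≤ k
    2≤k = ℕ.≤-trans 2≤m m≤k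

    1≤m : 1 ℕ.≤ m
    1≤m = ℕ.<⇒≤ 2≤m

    1≤k : 1 ℕ.≤ k
    1≤k = ℕ.<⇒≤ 2≤k

    instance
      k≢0 : ℕ.NonZero k
      k≢0 = ℕ.>-nonZero 1≤k

    L : ℝ
    L = log Δ * ε ⁻¹

    g≤ : ι (suc g) ≤ D * L
    g≤ with n , L≤n , n≤L+1 ← ceiling L (0≤G Δ₀≤Δ 0<ε ε<1) =
      ≤-trans (ι-mono-≤ (ℕ.s≤s (∣guesses∣≤ U-guesses {n} L≤n))) (ι[2+n]≤DG Δ₀≤Δ 0<ε ε<1 {n} n≤L+1)

    scaled′ : ∀ {t a z Z} → t ℕ.≤ a ℕ.* (suc g ℕ.* z) → a ℕ.≤ 175 → ι z ≤ E * Z → ι t ≤ C * (L * Z)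
    scaled′ {z = z} t≤ a≤175 z≤ = scaled Δ₀≤Δ 0<ε ε<1 {h = suc g} {z = z} t≤ a≤175 g≤ z≤

    -- The factor 5 leaves room for the costs of streaming per guess, such as the 2km stored
    -- elements, so that the constant of the post-processing covers them too.
    ιn≤E*ιn : ∀ n → ι (5 ℕ.* n) ≤ E * ι n
    ιn≤E*ιn n = ≤-trans (≤-reflexive (ι-* 5 n)) (*-monoˡ-≤ (ι n) (0≤ι n) ι5≤E)

    invariant : ∀ ys {σ t} → consume ys (initial U) ⇓ σ after t → Invariant g σ
    invariant ys e = proj₂ (bound (consume-takes ys (initial U) (initial-invariant U)) e)

    k+mk≤2km : k ℕ.+ m ℕ.* k ℕ.≤ 2 ℕ.* (k ℕ.* m)
    k+mk≤2km = ℕ.≤-trans (ℕ.+-monoˡ-≤ (m ℕ.* k) (ℕ.m≤n*m k m {{ℕ.>-nonZero 1≤m}})) (ℕ.≤-reflexive (eq k m))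
      where
      eq : ∀ k m → m ℕ.* k ℕ.+ m ℕ.* k ≡ 2 ℕ.* (k ℕ.* m)
      eq = solve-∀

    storage : ∀ {σ} → Invariant g σ → ι (stored σ) ≤ C * (ι k * ι m * log Δ * ε ⁻¹)
    storage {σ} inv = begin
      ι (stored σ)                       ≤⟨ scaled′ {a = 1} {z = 5 ℕ.* (k ℕ.* m)} stored≤′
                                              (ℕ.s≤s ℕ.z≤n) (ιn≤E*ιn (k ℕ.* m)) ⟩
      C * (L * ι (k ℕ.* m))              ≡⟨ cong (λ x → C * (L * x)) (ι-* k m) ⟩
      C * (L * (ι k * ι m))              ≡⟨ cong (C *_) (solve 4 (λ l e k m → (l :* e) :* (k :* m) := k :* m :* l :* e)
                                              refl (log Δ) (ε ⁻¹) (ι k) (ι m)) ⟩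
      C * (ι k * ι m * log Δ * ε ⁻¹)     ∎
      where
      stored≤′ : stored σ ℕ.≤ 1 ℕ.* (suc g ℕ.* (5 ℕ.* (k ℕ.* m)))
      stored≤′ = ℕ.≤-trans (stored≤ σ inv) (ℕ.≤-trans
        (ℕ.*-mono-≤ (ℕ.n≤1+n g) (ℕ.≤-trans k+mk≤2km (ℕ.*-monoˡ-≤ (k ℕ.* m) {2} {5} (ℕ.s≤s (ℕ.s≤s ℕ.z≤n)))))
        (ℕ.≤-reflexive (sym (ℕ.*-identityˡ _))))

    arrivalTime : ∀ x {σ σ′ t} → Invariant g σ → arrive x σ ⇓ σ′ after t → ι t ≤ C * (ι k * log Δ * ε ⁻¹)
    arrivalTime x {σ} {t = t} inv e = begin
      ι t                                ≤⟨ scaled′ {a = 17} {z = 5 ℕ.* k} t≤ (ℕ.m≤m+n 17 _) (ιn≤E*ιn k) ⟩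
      C * (L * ι k)                      ≡⟨ cong (C *_) (solve 3 (λ l e k → (l :* e) :* k := k :* l :* e)
                                              refl (log Δ) (ε ⁻¹) (ι k)) ⟩
      C * (ι k * log Δ * ε ⁻¹)           ∎
      where
      rearrange : ∀ g k → (1 ℕ.+ g ℕ.* 17) ℕ.* k ℕ.+ (84 ℕ.* k ℕ.+ 68 ℕ.* (g ℕ.* k)) ≡
                          17 ℕ.* (suc g ℕ.* (5 ℕ.* k))
      rearrange = solve-∀
      t≤ : t ℕ.≤ 17 ℕ.* (suc g ℕ.* (5 ℕ.* k))
      t≤ = ℕ.≤-trans (proj₁ (bound (arrive-takes x σ inv) e))
        (ℕ.≤-trans (ℕ.m≤m+n _ _) (ℕ.≤-reflexive (rearrange g k)))

    u : ℕ
    u = 2 ℕ.* (k ℕ.* m)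

    ℓ : ℝ
    ℓ = log (ι k) ^ 2

    0≤ℓ : 0# ≤ ℓ
    0≤ℓ = *-nonNegative 0≤log-k (*-nonNegative 0≤log-k 0≤1)
      where 0≤log-k = 0≤log (≤-trans (x≤x+y 1# (0≤ι 0)) (ι-mono-≤ 1≤k))

    0≤run : ∀ n → 0# ≤ ι n * ι k * ℓ
    0≤run n = *-nonNegative (*-nonNegative (0≤ι n) (0≤ι k)) 0≤ℓ

    -- Taken at the largest possible ground set, with `u` elements, so that a single ρ serves all
    -- guesses.
    runTime : ∃[ ρ ] c⁺ * (ι u * ι k * ℓ) ≤ ι ρ × ι ρ ≤ c⁺ * (ι u * ι k * ℓ) + 1#
    runTime = ceiling _ (*-nonNegative 0≤c⁺ (0≤run u))

    ρ : ℕ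
    ρ = proj₁ runTime

    run-takes : ∀ {n} (M₁ M₂ : PartitionMatroid n) → 1 ℕ.≤ n → n ℕ.≤ u →
                (∀ S → PartitionMatroid.Independent M₁ S → ∣ S ∣ ℕ.≤ k) →
                ∀ S → Takes (FastCunningham.run F M₁ M₂ S) 1 (u ℕ.* u ℕ.+ ρ) Always
    run-takes {n} M₁ M₂ 1≤n n≤u M₁≤k S .bound {t = t} e =
      ℕ.≤-trans (ι-cancel-≤ t≤ρ) (ℕ.≤-trans (ℕ.m≤n+m ρ (u ℕ.* u)) (ℕ.≤-reflexive (sym (ℕ.*-identityˡ _)))) , tt
      where
      t≤ρ : ι t ≤ ι ρ
      t≤ρ = begin
        ι t                        ≤⟨ FastCunningham.fast F M₁ M₂ 1≤n k 2≤k (λ S S∈I₁ _ → M₁≤k S S∈I₁) e ⟩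
        c₀ * (ι n * ι k * ℓ)       ≤⟨ *-monoˡ-≤ _ (0≤run n) c₀≤c⁺ ⟩
        c⁺ * (ι n * ι k * ℓ)       ≤⟨ *-monoʳ-≤ c⁺ 0≤c⁺ (*-monoˡ-≤ ℓ 0≤ℓ (*-monoˡ-≤ (ι k) (0≤ι k) (ι-mono-≤ n≤u))) ⟩
        c⁺ * (ι u * ι k * ℓ)       ≤⟨ proj₁ (proj₂ runTime) ⟩
        ι ρ                        ∎

    postProcessingTime : ∀ {σ result t} → Invariant g σ → postProcess F σ ⇓ result after t →
                         ι t ≤ C * (ι k ^ 2 * ι m * log Δ * ε ⁻¹ * (ι m + ℓ))
    postProcessingTime {σ} {t = t} inv e = begin
      ι t
        ≤⟨ scaled′ {a = 175} {z = u ℕ.* u ℕ.+ ρ}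
             (proj₁ (bound (postProcess-takes F 2≤k 1≤m k+mk≤2km (ℕ.m≤m+n _ ρ) run-takes σ inv) e))
             ℕ.≤-refl (guess-cost≤ k m ρ 1≤k 1≤m (proj₂ (proj₂ runTime)) 0≤ℓ) ⟩
      C * (L * (ι k ^ 2 * ι m * (ι m + ℓ)))
        ≡⟨ cong (C *_) (solve 5 (λ l e k m s → (l :* e) :* (k :* m :* s) := k :* m :* l :* e :* s)
             refl (log Δ) (ε ⁻¹) (ι k ^ 2) (ι m) (ι m + ℓ)) ⟩
      C * (ι k ^ 2 * ι m * log Δ * ε ⁻¹ * (ι m + ℓ)) ∎
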